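{- Let $G\subset GL_2(\mathbb R)$ be a finite subgroup which is not generated in codimension $1$. Then $\mathcal R_1G$ is the trivial group and, up to conjugation in $GL_2(\mathbb R)$, $$G=\mu_2(n):=\mathcal R_2I_2(n)$$ for some $n\geq 2$. Moreover, the lattice $\mathcal L(\mathcal A^G)$ consists only of the origin $O$ and the full space $V=\mathbb R^2$.
   Context: For $g\in G$, $V^{\langle g\rangle}$ is the subspace of vectors of $V=\mathbb R^2$ fixed by $g$; for a subgroup $H\subset G$, $V^H$ is the subspace of vectors fixed by every element of $H$. $G$ is generated in codimension $1$ if it is generated by its elements $g$ with $\operatorname{codim}V^{\langle g\rangle}\le 1$. $\mathcal R_1G$ (resp. $\mathcal R_2G$) is the subgroup of $G$ generated by its reflections, i.e. its elements with $\operatorname{codim}V^{\langle g\rangle}=1$ (resp. by its rotations, i.e. its elements with $\operatorname{codim}V^{\langle g\rangle}=2$). For $n\ge 2$, $I_2(n)\subset O_2(\mathbb R)$ is the dihedral reflection group of order $2n$: the symmetry group of $n$ equidistant points on the unit circle if $n\geq3$, and $\{\operatorname{diag}(\pm1,\pm1)\}$ if $n=2$. A subgroup $H\subset G$ is a stabilizer subgroup if $H=\{g\in G\mid gv=v\ \text{for all } v\in V^H\}$. The subspace arrangement of $G$ is $\mathcal A^G=\{V^H\mid \{e\}\neq H \text{ a stabilizer subgroup}\}$, and $\mathcal L(\mathcal A^G)$ is the set of all intersections of subfamilies of $\mathcal A^G$ (the empty intersection being $V$), ordered by reverse inclusion. -}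

module Defs where

open import Algebra.Bundles using (CommutativeRing; Group)
open import Algebra.Structures using (IsCommutativeRing)
import Algebra.Properties.Semiring.Sum as SemiringSum
import Algebra.Solver.Ring.NaturalCoefficients.Default as RingSolver
open import Data.Fin.Base using (Fin; zero; suc)
open import Data.List.Base using (List)
import Data.List.Membership.Setoid as Membership
open import Data.Nat.Base as ℕ using (ℕ)
open import Data.Product.Base using (Σ-syntax; ∃; ∃-syntax; _×_; _,_)
open import Data.Sum.Base using (_⊎_)
open import Data.Vec.Functional using (Vector)
open import Level using (0ℓ; _⊔_) renaming (suc to lsuc)
open import Relation.Binary.Core using (Rel)
open import Relation.Binary.Structures using (IsTotalOrder)
open import Relation.Binary.PropositionalEquality.Core using (_≡_)
open import Relation.Nullary.Negation.Core using (¬_)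
open import Relation.Unary using (Pred; _∈_; _⊆_; _≐_; _∩_; Satisfiable)

-- The axioms characterising ℝ up to isomorphism (the standard library has no
-- construction of the real numbers).
record CompleteOrderedField : Set₁ where
  infix  8 -_
  infixl 7 _*_
  infixl 6 _+_
  infix  4 _≈_ _≤_
  field
    Carrier           : Set
    _≈_               : Rel Carrier 0ℓ
    _≤_               : Rel Carrier 0ℓ
    _+_ _*_           : Carrier → Carrier → Carrier
    -_                : Carrier → Carrier
    0# 1#             : Carrier
    isCommutativeRing : IsCommutativeRing _≈_ _+_ _*_ -_ 0# 1#
    1≉0               : ¬ 1# ≈ 0#
    inverse           : ∀ x → ¬ x ≈ 0# → ∃[ y ] x * y ≈ 1#
    ≤-isTotalOrder    : IsTotalOrder _≈_ _≤_
    +-monoˡ-≤         : ∀ z {x y} → x ≤ y → x + z ≤ y + z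
    *-nonNegative     : ∀ {x y} → 0# ≤ x → 0# ≤ y → 0# ≤ x * y

  UpperBound : Pred Carrier 0ℓ → Pred Carrier 0ℓ
  UpperBound P b = ∀ x → P x → x ≤ b

  field
    supremum : ∀ (P : Pred Carrier 0ℓ) → Satisfiable P → Satisfiable (UpperBound P) →
               ∃[ s ] (UpperBound P s × (∀ b → UpperBound P b → s ≤ b))

  commutativeRing : CommutativeRing 0ℓ 0ℓ
  commutativeRing = record { isCommutativeRing = isCommutativeRing }


module Subgroups {c ℓ} (𝔾 : Group c ℓ) where
  open Group 𝔾
  open Membership setoid using () renaming (_∈_ to _∈ˡ_)

  record IsSubgroup {p} (H : Pred Carrier p) : Set (c ⊔ ℓ ⊔ p) where
    field
      resp      : ∀ {x y} → x ≈ y → x ∈ H → y ∈ H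
      ε-closed  : ε ∈ H
      ∙-closed  : ∀ {x y} → x ∈ H → y ∈ H → x ∙ y ∈ H
      ⁻¹-closed : ∀ {x} → x ∈ H → x ⁻¹ ∈ H

  Finite : ∀ {p} → Pred Carrier p → Set (c ⊔ ℓ ⊔ p)
  Finite H = Σ[ xs ∈ List Carrier ] H ≐ (_∈ˡ xs)

  Trivial : Pred Carrier ℓ
  Trivial x = x ≈ ε

  data ⟨_⟩ {p} (S : Pred Carrier p) : Pred Carrier (c ⊔ ℓ ⊔ p) where
    gen  : ∀ {x} → x ∈ S → x ∈ ⟨ S ⟩
    unit : ε ∈ ⟨ S ⟩
    mul  : ∀ {x y} → x ∈ ⟨ S ⟩ → y ∈ ⟨ S ⟩ → x ∙ y ∈ ⟨ S ⟩
    inv  : ∀ {x} → x ∈ ⟨ S ⟩ → x ⁻¹ ∈ ⟨ S ⟩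
    resp : ∀ {x y} → x ≈ y → x ∈ ⟨ S ⟩ → y ∈ ⟨ S ⟩

  -- conjugate k H = k H k⁻¹, for H closed under _≈_.
  conjugate : ∀ {p} → Carrier → Pred Carrier p → Pred Carrier p
  conjugate k H x = (k ⁻¹ ∙ x) ∙ k ∈ H

  EqualUpToConjugation : ∀ {p q} → Pred Carrier p → Pred Carrier q → Set (c ⊔ p ⊔ q)
  EqualUpToConjugation H K = ∃[ k ] conjugate k H ≐ K


module Plane (ℝ : CompleteOrderedField) where
  open CompleteOrderedField ℝ public using (_≤_)
  open CommutativeRing (CompleteOrderedField.commutativeRing ℝ) public
    using (Carrier; _≈_; _+_; _*_; -_; _-_; 0#; 1#)
  private module R = CommutativeRing (CompleteOrderedField.commutativeRing ℝ)
  open SemiringSum R.semiring using (sum)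

  private
    pattern i₀ = zero
    pattern i₁ = suc zero

  V : Set
  V = Vector Carrier 2

  infix 4 _≈ᵥ_ _≈ₘ_
  infixl 7 _·_ _·ᵥ_

  _≈ᵥ_ : Rel V 0ℓ
  v ≈ᵥ w = ∀ i → v i ≈ w i

  0ᵥ : V
  0ᵥ _ = 0#

  Origin : Pred V 0ℓ
  Origin v = v ≈ᵥ 0ᵥ

  Matrix : Set
  Matrix = Fin 2 → Fin 2 → Carrier

  _≈ₘ_ : Rel Matrix 0ℓ
  A ≈ₘ B = ∀ i j → A i j ≈ B i j

  _·_ : Matrix → Matrix → Matrix
  (A · B) i j = A i i₀ * B i₀ j + A i i₁ * B i₁ j

  _·ᵥ_ : Matrix → V → V
  (A ·ᵥ v) i = A i i₀ * v i₀ + A i i₁ * v i₁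

  diag : Carrier → Carrier → Matrix
  diag a d i₀ i₀ = a
  diag a d i₀ i₁ = 0#
  diag a d i₁ i₀ = 0#
  diag a d i₁ i₁ = d

  I : Matrix
  I = diag 1# 1#

  _ᵀ : Matrix → Matrix
  (A ᵀ) i j = A j i

  record GL₂ : Set where
    field
      mat     : Matrix
      mat⁻¹   : Matrix
      inverseˡ : mat⁻¹ · mat ≈ₘ I
      inverseʳ : mat · mat⁻¹ ≈ₘ I
  open GL₂ public

  private
    ·-cong : ∀ {A B C D} → A ≈ₘ B → C ≈ₘ D → A · C ≈ₘ B · D
    ·-cong p q i j = R.+-cong (R.*-cong (p i i₀) (q i₀ j)) (R.*-cong (p i i₁) (q i₁ j))

    ≈ₘ-refl : ∀ {A} → A ≈ₘ A
    ≈ₘ-refl _ _ = R.refl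

    ≈ₘ-sym : ∀ {A B} → A ≈ₘ B → B ≈ₘ A
    ≈ₘ-sym p i j = R.sym (p i j)

    infixr 5 _⟫_
    _⟫_ : ∀ {A B C} → A ≈ₘ B → B ≈ₘ C → A ≈ₘ C
    (p ⟫ q) i j = R.trans (p i j) (q i j)

    ·-assoc : ∀ A B C → (A · B) · C ≈ₘ A · (B · C)
    ·-assoc A B C i j = solve 8 (λ a₀ a₁ b₀₀ b₀₁ b₁₀ b₁₁ c₀ c₁ →
        (a₀ :* b₀₀ :+ a₁ :* b₁₀) :* c₀ :+ (a₀ :* b₀₁ :+ a₁ :* b₁₁) :* c₁ :=
        a₀ :* (b₀₀ :* c₀ :+ b₀₁ :* c₁) :+ a₁ :* (b₁₀ :* c₀ :+ b₁₁ :* c₁))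
        R.refl (A i i₀) (A i i₁) (B i₀ i₀) (B i₀ i₁) (B i₁ i₀) (B i₁ i₁) (C i₀ j) (C i₁ j)
      where open RingSolver R.commutativeSemiring

    module _ where
      open RingSolver R.commutativeSemiring

      ·-identityˡ : ∀ A → I · A ≈ₘ A
      ·-identityˡ A i₀ j = solve 2 (λ x y → con 1 :* x :+ con 0 :* y := x) R.refl (A i₀ j) (A i₁ j)
      ·-identityˡ A i₁ j = solve 2 (λ x y → con 0 :* x :+ con 1 :* y := y) R.refl (A i₀ j) (A i₁ j)

      ·-identityʳ : ∀ A → A · I ≈ₘ A
      ·-identityʳ A i i₀ = solve 2 (λ x y → x :* con 1 :+ y :* con 0 := x) R.refl (A i i₀) (A i i₁)
      ·-identityʳ A i i₁ = solve 2 (λ x y → x :* con 0 :+ y :* con 1 := y) R.refl (A i i₀) (A i i₁)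

    cancel : ∀ A B C D → A · B ≈ₘ I → C · D ≈ₘ I → (C · A) · (B · D) ≈ₘ I
    cancel A B C D p q =
      ·-assoc C A (B · D) ⟫
      ·-cong (≈ₘ-refl {C}) (≈ₘ-sym (·-assoc A B D) ⟫ ·-cong p (≈ₘ-refl {D}) ⟫ ·-identityˡ D) ⟫
      q

    inverse-unique : ∀ A B A′ B′ → A ≈ₘ B → A′ · A ≈ₘ I → B · B′ ≈ₘ I → A′ ≈ₘ B′
    inverse-unique A B A′ B′ A≈B A′A≈I BB′≈I =
      ≈ₘ-sym (·-identityʳ A′) ⟫
      ·-cong (≈ₘ-refl {A′}) (≈ₘ-sym BB′≈I ⟫ ·-cong (≈ₘ-sym A≈B) (≈ₘ-refl {B′})) ⟫
      ≈ₘ-sym (·-assoc A′ A B′) ⟫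
      ·-cong A′A≈I (≈ₘ-refl {B′}) ⟫
      ·-identityˡ B′

  GL₂-group : Group 0ℓ 0ℓ
  GL₂-group = record
    { Carrier = GL₂
    ; _≈_     = λ g h → mat g ≈ₘ mat h
    ; _∙_     = λ g h → record
      { mat      = mat g · mat h
      ; mat⁻¹    = mat⁻¹ h · mat⁻¹ g
      ; inverseˡ = cancel (mat⁻¹ g) (mat g) (mat⁻¹ h) (mat h) (inverseˡ g) (inverseˡ h)
      ; inverseʳ = cancel (mat h) (mat⁻¹ h) (mat g) (mat⁻¹ g) (inverseʳ h) (inverseʳ g)
      }
    ; ε       = record
      { mat = I ; mat⁻¹ = I ; inverseˡ = ·-identityˡ I ; inverseʳ = ·-identityˡ I }
    ; _⁻¹     = λ g → record
      { mat = mat⁻¹ g ; mat⁻¹ = mat g ; inverseˡ = inverseʳ g ; inverseʳ = inverseˡ g }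
    ; isGroup = record
      { isMonoid = record
        { isSemigroup = record
          { isMagma = record
            { isEquivalence = record { refl = ≈ₘ-refl ; sym = ≈ₘ-sym ; trans = _⟫_ }
            ; ∙-cong        = ·-cong
            }
          ; assoc = λ g h k → ·-assoc (mat g) (mat h) (mat k)
          }
        ; identity = (λ g → ·-identityˡ (mat g)) , (λ g → ·-identityʳ (mat g))
        }
      ; inverse = inverseˡ , inverseʳ
      ; ⁻¹-cong = λ {g} {h} g≈h → inverse-unique (mat g) (mat h) (mat⁻¹ g) (mat⁻¹ h) g≈h (inverseˡ g) (inverseʳ h)
      }
    }

  open Subgroups GL₂-group public

  Fix : GL₂ → Pred V 0ℓ
  Fix g v = mat g ·ᵥ v ≈ᵥ v

  Fixed : Pred GL₂ 0ℓ → Pred V 0ℓ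
  Fixed H v = ∀ g → g ∈ H → v ∈ Fix g

  linearCombination : ∀ {d} → Vector Carrier d → Vector V d → V
  linearCombination c b i = sum (λ k → c k * b k i)

  record IsBasis (W : Pred V 0ℓ) {d} (b : Vector V d) : Set where
    field
      member      : ∀ k → b k ∈ W
      independent : ∀ c → linearCombination c b ≈ᵥ 0ᵥ → ∀ k → c k ≈ 0#
      spanning    : ∀ {v} → v ∈ W → ∃[ c ] linearCombination c b ≈ᵥ v

  Dimension : Pred V 0ℓ → ℕ → Set
  Dimension W d = Σ[ b ∈ Vector V d ] IsBasis W b

  Codimension : Pred V 0ℓ → ℕ → Set
  Codimension W c = ∃[ d ] (Dimension W d × d ℕ.+ c ≡ 2)

  CodimAtMost1 Reflection Rotation : Pred GL₂ 0ℓ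
  CodimAtMost1 g = ∃[ c ] (c ℕ.≤ 1 × Codimension (Fix g) c)
  Reflection g = Codimension (Fix g) 1
  Rotation g = Codimension (Fix g) 2

  GeneratedInCodim1 : Pred GL₂ 0ℓ → Set
  GeneratedInCodim1 G = ⟨ G ∩ CodimAtMost1 ⟩ ≐ G

  𝓡₁ 𝓡₂ : Pred GL₂ 0ℓ → Pred GL₂ 0ℓ
  𝓡₁ G = ⟨ G ∩ Reflection ⟩
  𝓡₂ G = ⟨ G ∩ Rotation ⟩

  distance² : V → V → Carrier
  distance² v w = (v i₀ - w i₀) * (v i₀ - w i₀) + (v i₁ - w i₁) * (v i₁ - w i₁)

  -- The n points are labelled in cyclic order around the circle, by ℕ with
  -- period n: the next label is at the same distance for every point, and no
  -- other point is closer.  Starting at (1,0) pins down the set of points as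
  -- { (cos (2πk/n), sin (2πk/n)) }, leaving only the sense of the labelling free.
  record EquidistantPoints (n : ℕ) : Set where
    field
      point       : ℕ → V
      periodic    : ∀ k → point (n ℕ.+ k) ≈ᵥ point k
      distinct    : ∀ {j k} → j ℕ.< n → k ℕ.< n → point j ≈ᵥ point k → j ≡ k
      start       : point 0 i₀ ≈ 1# × point 0 i₁ ≈ 0#
      onCircle    : ∀ k → distance² (point k) 0ᵥ ≈ 1#
      equidistant : ∀ j k → distance² (point j) (point (ℕ.suc j)) ≈
                            distance² (point k) (point (ℕ.suc k))
      nearest     : ∀ j k → ¬ point k ≈ᵥ point j →
                    distance² (point j) (point (ℕ.suc j)) ≤ distance² (point j) (point k)

    Points : Pred V 0ℓ
    Points v = ∃[ k ] v ≈ᵥ point k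

  Orthogonal : Pred GL₂ 0ℓ
  Orthogonal g = (mat g ᵀ) · mat g ≈ₘ I

  PreservesSet : Pred V 0ℓ → Pred GL₂ 0ℓ
  PreservesSet S g = (∀ {v} → v ∈ S → mat g ·ᵥ v ∈ S)
                   × (∀ {w} → w ∈ S → ∃[ v ] (v ∈ S × mat g ·ᵥ v ≈ᵥ w))

  SymmetryGroup : Pred V 0ℓ → Pred GL₂ 0ℓ
  SymmetryGroup S = Orthogonal ∩ PreservesSet S

  SignDiagonal : Pred GL₂ 0ℓ
  SignDiagonal g = ∃[ a ] ∃[ d ] ((a ≈ 1# ⊎ a ≈ - 1#) × (d ≈ 1# ⊎ d ≈ - 1#) × mat g ≈ₘ diag a d)

  -- IsI₂ n D: the subgroup D of GL₂ is the dihedral reflection group I₂(n).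
  data IsI₂ : ℕ → Pred GL₂ 0ℓ → Set₁ where
    two     : ∀ {D} → D ≐ SignDiagonal → IsI₂ 2 D
    polygon : ∀ {n D} → 3 ℕ.≤ n → (P : EquidistantPoints n) →
              D ≐ SymmetryGroup (EquidistantPoints.Points P) → IsI₂ n D

  record IsStabilizerSubgroup (G H : Pred GL₂ 0ℓ) : Set where
    field
      isSubgroup : IsSubgroup H
      contained  : H ⊆ G
      stabilizer : H ≐ (λ g → g ∈ G × (∀ v → v ∈ Fixed H → v ∈ Fix g))

  𝓐 : Pred GL₂ 0ℓ → Pred (Pred V 0ℓ) (lsuc 0ℓ)
  𝓐 G W = Σ[ H ∈ Pred GL₂ 0ℓ ] (IsStabilizerSubgroup G H × ¬ H ≐ Trivial × W ≐ Fixed H)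

  Intersection : Pred (Pred V 0ℓ) (lsuc 0ℓ) → Pred V (lsuc 0ℓ)
  Intersection F v = ∀ W → W ∈ F → v ∈ W

  𝓛 : Pred (Pred V 0ℓ) (lsuc 0ℓ) → Pred (Pred V 0ℓ) (lsuc (lsuc 0ℓ))
  𝓛 𝓕 X = Σ[ F ∈ Pred (Pred V 0ℓ) (lsuc 0ℓ) ] (F ⊆ 𝓕 × X ≐ Intersection F)

-- Summing the forms gᵀg over g ∈ G yields a G-invariant inner product, so that G is
-- conjugate into O₂.  There the elements of determinant -1 are exactly the reflections.
-- If G contained a reflection g, every h ∈ G of determinant 1 would be the product of
-- the reflections g⁻¹ and g h, and G would be generated in codimension 1.  So G is
-- conjugate to a nontrivial finite group of rotations.  It is generated by a rotation
-- g ≠ 1 with the largest cosine: an element u ≠ 1 of a coset h⟨g⟩ is turned towards 1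
-- by g or by g⁻¹, so the element of the coset nearest to 1 is 1 itself.  For n ≥ 3 the
-- orbit of (1 , 0) is the regular n-gon whose rotations are the powers of g.  As a
-- nontrivial rotation fixes only the origin, the arrangement is { O }.
module Submission where

open import Defs
open import Algebra.Bundles using (CommutativeMonoid; CommutativeRing; Group)
import Algebra.Properties.AbelianGroup
import Algebra.Properties.Group
import Algebra.Properties.Monoid.Mult
import Algebra.Properties.Ring
import Algebra.Properties.Semiring.Mult.TCOptimised
import Algebra.Solver.Ring
open import Algebra.Solver.Ring.AlmostCommutativeRing using (_-Raw-AlmostCommutative⟶_; fromCommutativeRing)
open import Axiom.ExcludedMiddle using (ExcludedMiddle)
open import Data.Empty using (⊥; ⊥-elim)
open import Data.Fin.Base using (zero; suc; toℕ)
open import Data.Fin.Properties using (pigeonhole)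
open import Data.Integer.Base as ℤ using (ℤ; +_; -[1+_]; _⊖_)
import Data.Integer.Properties as ℤ
open import Data.List.Base using (List; []; _∷_; _++_; deduplicate; foldr; length; map)
import Data.List.Membership.Setoid as Membership
import Data.List.Membership.Setoid.Properties as Membershipₚ
import Data.List.Relation.Binary.Permutation.Setoid as Permutation
import Data.List.Relation.Binary.Permutation.Setoid.Properties as Permutationₚ
import Data.List.Relation.Unary.All as All
open import Data.List.Relation.Unary.AllPairs using ([]; _∷_)
open import Data.List.Relation.Unary.Any as Any using (here; there)
import Data.List.Relation.Unary.Unique.DecSetoid.Properties as UniqueDec
import Data.List.Relation.Unary.Unique.Setoid as Unique
import Data.List.Relation.Unary.Unique.Setoid.Properties as Uniqueₚ
open import Data.Maybe.Base using (Maybe; just; nothing)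
open import Data.Nat.Base as ℕ using (ℕ; zero; suc; s≤s; z≤n) renaming (_≤_ to _≤ℕ_)
open import Data.Nat.Induction using (<-rec)
import Data.Nat.Properties as ℕ
open import Data.Product.Base using (Σ-syntax; ∃-syntax; _×_; _,_; proj₁; proj₂)
open import Data.Sum.Base using (_⊎_; inj₁; inj₂)
open import Data.Unit.Base using (tt)
open import Function.Bundles using (_⇔_; mk⇔)
open import Level using (0ℓ; Lift; lift; lower) renaming (suc to lsuc)
open import Relation.Binary.Bundles using (Setoid; TotalOrder)
open import Relation.Binary.Definitions using (tri<; tri≈; tri>)
open import Relation.Binary.PropositionalEquality.Core as ≡ using (_≡_)
import Relation.Binary.Reasoning.Setoid
open import Relation.Binary.Structures using (IsTotalOrder)
open import Relation.Nullary.Decidable.Core using (Dec; yes; no; map′)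
open import Relation.Nullary.Negation.Core using (¬_)
open import Relation.Unary using (Pred; _∈_; _⊆_; _≐_; _∩_; U)

-- Angles never occur. A rotation is recorded by its first column (`re`, `im`) with re² + im² = 1,
-- the size of its angle is measured by `re`, and the comparison of cosines is a polynomial
-- inequality proved by squaring. Fixed spaces are controlled by det (A - I) = det A - tr A + 1,
-- which conjugation preserves; so reflections can be recognised in G itself although the
-- orthogonality relations hold only for its conjugate. Completeness enters once, for the square
-- root that diagonalises the invariant form. Excluded middle decides equality of matrices and
-- thereby gives a repetition-free list of G, whose entries a right translation permutes. Instead of
-- dividing an angle by the smallest one with remainder, the generation argument maximises `re` over
-- a coset. The trivial group counts as generated in codimension 1, so the hypothesis supplies an
-- element other than 1, and this is where n ≥ 2 comes from.

-- Polynomial identities with integer coefficients in a commutative ring.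

module IntegerCoefficients {c ℓ} (R : CommutativeRing c ℓ) where
  open CommutativeRing R
  open Algebra.Properties.Ring ring using (-‿distribˡ-*; -‿distribʳ-*; -0#≈0#)
  open Algebra.Properties.AbelianGroup +-abelianGroup using (⁻¹-∙-comm; ⁻¹-involutive)
  open Algebra.Properties.Semiring.Mult.TCOptimised semiring using (×-homo-+; ×1-homo-*; 1+×) renaming (_×_ to _×ᴿ_)
  open Relation.Binary.Reasoning.Setoid setoid

  -- With this form of the multiples the integers 0, 1 and 2 evaluate definitionally to `0#`, `1#`
  -- and `1# + 1#`, so that identities solved with `:0`, `:1`, `:2` fit their goals without
  -- conversion.
  ⟦_⟧ : ℤ → Carrier
  ⟦ + n ⟧      = n ×ᴿ 1#
  ⟦ -[1+ n ] ⟧ = - (suc n ×ᴿ 1#)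

  ⊖-homo : ∀ m n → ⟦ m ⊖ n ⟧ ≈ m ×ᴿ 1# - n ×ᴿ 1#
  ⊖-homo zero    zero    = sym (-‿inverseʳ 0#)
  ⊖-homo zero    (suc n) = sym (+-identityˡ _)
  ⊖-homo (suc m) zero    = sym (trans (+-congˡ -0#≈0#) (+-identityʳ _))
  ⊖-homo (suc m) (suc n) = begin
    ⟦ suc m ⊖ suc n ⟧                      ≡⟨ ≡.cong ⟦_⟧ (ℤ.[1+m]⊖[1+n]≡m⊖n m n) ⟩
    ⟦ m ⊖ n ⟧                              ≈⟨ ⊖-homo m n ⟩
    m ×ᴿ 1# - n ×ᴿ 1#                      ≈⟨ +-congʳ (+-identityʳ _) ⟨
    m ×ᴿ 1# + 0# - n ×ᴿ 1#                 ≈⟨ +-congʳ (+-congˡ (-‿inverseʳ 1#)) ⟨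
    m ×ᴿ 1# + (1# - 1#) - n ×ᴿ 1#          ≈⟨ +-congʳ (+-assoc _ _ _) ⟨
    (m ×ᴿ 1# + 1#) - 1# - n ×ᴿ 1#          ≈⟨ +-assoc _ _ _ ⟩
    (m ×ᴿ 1# + 1#) + (- 1# - n ×ᴿ 1#)      ≈⟨ +-cong (+-comm _ _) (⁻¹-∙-comm _ _) ⟩
    (1# + m ×ᴿ 1#) - (1# + n ×ᴿ 1#)        ≈⟨ +-cong (1+× m 1#) (-‿cong (1+× n 1#)) ⟨
    suc m ×ᴿ 1# - suc n ×ᴿ 1#              ∎

  +-homo : ∀ i j → ⟦ i ℤ.+ j ⟧ ≈ ⟦ i ⟧ + ⟦ j ⟧
  +-homo (+ m)    (+ n)    = ×-homo-+ 1# m n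
  +-homo (+ m)    -[1+ n ] = ⊖-homo m (suc n)
  +-homo -[1+ m ] (+ n)    = trans (⊖-homo n (suc m)) (+-comm _ _)
  +-homo -[1+ m ] -[1+ n ] = begin
    - (suc (suc (m ℕ.+ n)) ×ᴿ 1#)       ≡⟨ ≡.cong (λ k → - (k ×ᴿ 1#)) (≡.cong suc (ℕ.+-suc m n)) ⟨
    - ((suc m ℕ.+ suc n) ×ᴿ 1#)         ≈⟨ -‿cong (×-homo-+ 1# (suc m) (suc n)) ⟩
    - (suc m ×ᴿ 1# + suc n ×ᴿ 1#)       ≈⟨ ⁻¹-∙-comm _ _ ⟨
    - (suc m ×ᴿ 1#) - suc n ×ᴿ 1#       ∎

  -‿homo : ∀ i → ⟦ ℤ.- i ⟧ ≈ - ⟦ i ⟧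
  -‿homo (+ zero)   = sym -0#≈0#
  -‿homo (+ suc n)  = refl
  -‿homo -[1+ n ]   = sym (⁻¹-involutive _)

  *-homo⁺ : ∀ m n → ⟦ + m ℤ.* + n ⟧ ≈ ⟦ + m ⟧ * ⟦ + n ⟧
  *-homo⁺ m n = begin
    ⟦ + m ℤ.* + n ⟧      ≡⟨ ≡.cong ⟦_⟧ (ℤ.pos-* m n) ⟨
    (m ℕ.* n) ×ᴿ 1#      ≈⟨ ×1-homo-* m n ⟩
    m ×ᴿ 1# * n ×ᴿ 1#    ∎

  *-homo : ∀ i j → ⟦ i ℤ.* j ⟧ ≈ ⟦ i ⟧ * ⟦ j ⟧
  *-homo (+ m)    (+ n)    = *-homo⁺ m n
  *-homo (+ m)    -[1+ n ] = begin
    ⟦ + m ℤ.* -[1+ n ] ⟧             ≡⟨ ≡.cong ⟦_⟧ (ℤ.neg-distribʳ-* (+ m) (+ suc n)) ⟨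
    ⟦ ℤ.- (+ m ℤ.* + suc n) ⟧        ≈⟨ -‿homo (+ m ℤ.* + suc n) ⟩
    - ⟦ + m ℤ.* + suc n ⟧            ≈⟨ -‿cong (*-homo⁺ m (suc n)) ⟩
    - (⟦ + m ⟧ * ⟦ + suc n ⟧)        ≈⟨ -‿distribʳ-* _ _ ⟩
    ⟦ + m ⟧ * - ⟦ + suc n ⟧          ∎
  *-homo -[1+ m ] (+ n)    = begin
    ⟦ -[1+ m ] ℤ.* + n ⟧             ≡⟨ ≡.cong ⟦_⟧ (ℤ.neg-distribˡ-* (+ suc m) (+ n)) ⟨
    ⟦ ℤ.- (+ suc m ℤ.* + n) ⟧        ≈⟨ -‿homo (+ suc m ℤ.* + n) ⟩
    - ⟦ + suc m ℤ.* + n ⟧            ≈⟨ -‿cong (*-homo⁺ (suc m) n) ⟩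
    - (⟦ + suc m ⟧ * ⟦ + n ⟧)        ≈⟨ -‿distribˡ-* _ _ ⟩
    - ⟦ + suc m ⟧ * ⟦ + n ⟧          ∎
  *-homo -[1+ m ] -[1+ n ] = begin
    ⟦ + suc m ℤ.* + suc n ⟧          ≈⟨ *-homo⁺ (suc m) (suc n) ⟩
    ⟦ + suc m ⟧ * ⟦ + suc n ⟧        ≈⟨ ⁻¹-involutive _ ⟨
    - - (⟦ + suc m ⟧ * ⟦ + suc n ⟧)  ≈⟨ -‿cong (-‿distribˡ-* _ _) ⟩
    - (- ⟦ + suc m ⟧ * ⟦ + suc n ⟧)  ≈⟨ -‿distribʳ-* _ _ ⟩
    - ⟦ + suc m ⟧ * - ⟦ + suc n ⟧    ∎

  morphism : ℤ.+-*-rawRing -Raw-AlmostCommutative⟶ fromCommutativeRing R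
  morphism = record
    { ⟦_⟧    = ⟦_⟧
    ; +-homo = +-homo
    ; *-homo = *-homo
    ; -‿homo = -‿homo
    ; 0-homo = refl
    ; 1-homo = refl
    }

  coefficient≟ : ∀ i j → Maybe (⟦ i ⟧ ≈ ⟦ j ⟧)
  coefficient≟ i j with i ℤ.≟ j
  ... | yes i≡j = just (reflexive (≡.cong ⟦_⟧ i≡j))
  ... | no _    = nothing

  open Algebra.Solver.Ring ℤ.+-*-rawRing (fromCommutativeRing R) morphism coefficient≟ public
    using (solve; Polynomial; _:+_; _:*_; _:-_; :-_; _:=_; con)

  :0 :1 :2 : ∀ {n} → Polynomial n
  :0 = con (+ 0)
  :1 = con (+ 1)
  :2 = con (+ 2)

-- Ordered field arithmetic and square roots.

module OrderedField (em : ExcludedMiddle 0ℓ) (ℝ : CompleteOrderedField) where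
  open CompleteOrderedField ℝ using (_≤_; inverse; 1≉0; ≤-isTotalOrder; +-monoˡ-≤; *-nonNegative; supremum)
  open CommutativeRing (CompleteOrderedField.commutativeRing ℝ)
  open IntegerCoefficients (CompleteOrderedField.commutativeRing ℝ)
  open IsTotalOrder ≤-isTotalOrder using (total; antisym) renaming (trans to ≤-trans; reflexive to ≤-reflexive)

  infix 4 _<_
  -- For a total order this is the strict order. As a negation it is proved by refuting the reverse
  -- inequality, and applying such a proof to that inequality yields a contradiction.
  _<_ : Carrier → Carrier → Set
  x < y = ¬ y ≤ x

  2# : Carrier
  2# = 1# + 1#

  ≤-resp : ∀ {x x′ y y′} → x ≈ x′ → y ≈ y′ → x ≤ y → x′ ≤ y′
  ≤-resp p q x≤y = ≤-trans (≤-reflexive (sym p)) (≤-trans x≤y (≤-reflexive q))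

  <⇒≤ : ∀ {x y} → x < y → x ≤ y
  <⇒≤ {x} {y} x<y with total x y
  ... | inj₁ x≤y = x≤y
  ... | inj₂ y≤x = ⊥-elim (x<y y≤x)

  ≮⇒≥ : ∀ {x y} → ¬ x < y → y ≤ x
  ≮⇒≥ {x} {y} x≮y with em {y ≤ x}
  ... | yes y≤x = y≤x
  ... | no y≰x  = ⊥-elim (x≮y y≰x)

  0≤y-x : ∀ {x y} → x ≤ y → 0# ≤ y - x
  0≤y-x {x} x≤y = ≤-resp (-‿inverseʳ x) refl (+-monoˡ-≤ (- x) x≤y)

  0≤y-x⁻¹ : ∀ {x y} → 0# ≤ y - x → x ≤ y
  0≤y-x⁻¹ {x} {y} p =
    ≤-resp (+-identityˡ x) (solve 2 (λ x y → (y :- x) :+ x := y) refl x y) (+-monoˡ-≤ x p)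

  ≤-byDifference : ∀ {x y d} → 0# ≤ d → y - x ≈ d → x ≤ y
  ≤-byDifference 0≤d eq = 0≤y-x⁻¹ (≤-resp refl (sym eq) 0≤d)

  <-byDifference : ∀ {x y d} → 0# < d → y - x ≈ d → x < y
  <-byDifference {x} {y} {d} 0<d eq y≤x = 0<d (≤-byDifference (0≤y-x y≤x)
    (trans (+-congˡ (-‿cong (sym eq))) (solve 2 (λ x y → :0 :- (y :- x) := x :- y) refl x y)))

  0<y-x : ∀ {x y} → x < y → 0# < y - x
  0<y-x {x} {y} x<y y-x≤0 =
    x<y (≤-byDifference (0≤y-x y-x≤0) (solve 2 (λ x y → x :- y := :0 :- (y :- x)) refl x y))

  +-nonNegative : ∀ {x y} → 0# ≤ x → 0# ≤ y → 0# ≤ x + y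
  +-nonNegative {x} {y} p q = ≤-trans q (≤-resp (+-identityˡ y) refl (+-monoˡ-≤ y p))

  +-positiveˡ : ∀ {x y} → 0# < x → 0# ≤ y → 0# < x + y
  +-positiveˡ {x} {y} p q x+y≤0 =
    p (≤-trans (≤-byDifference q (solve 2 (λ x y → (x :+ y) :- x := y) refl x y)) x+y≤0)

  +-positiveʳ : ∀ {x y} → 0# ≤ x → 0# < y → 0# < x + y
  +-positiveʳ p q s = +-positiveˡ q p (≤-resp (+-comm _ _) refl s)

  neg-nonNegative : ∀ {x} → x ≤ 0# → 0# ≤ - x
  neg-nonNegative p = ≤-resp refl (+-identityˡ _) (0≤y-x p)

  square-nonNegative : ∀ x → 0# ≤ x * x
  square-nonNegative x with total 0# x
  ... | inj₁ p = *-nonNegative p p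
  ... | inj₂ p = ≤-resp refl (solve 1 (λ x → (:- x) :* (:- x) := x :* x) refl x)
                   (*-nonNegative (neg-nonNegative p) (neg-nonNegative p))

  integral : ∀ {x y} → ¬ x ≈ 0# → x * y ≈ 0# → y ≈ 0#
  integral {x} {y} x≉0 xy≈0 with inverse x x≉0
  ... | z , xz≈1 = trans (sym (*-identityˡ y)) (trans (*-congʳ (sym xz≈1))
                     (trans (solve 3 (λ x y z → (x :* z) :* y := z :* (x :* y)) refl x y z)
                       (trans (*-congˡ xy≈0) (zeroʳ z))))

  square-zero : ∀ {x} → x * x ≈ 0# → x ≈ 0#
  square-zero {x} p with em {x ≈ 0#}
  ... | yes x≈0 = x≈0
  ... | no x≉0  = integral x≉0 p

  0≤∧≉⇒0< : ∀ {x} → 0# ≤ x → ¬ x ≈ 0# → 0# < x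
  0≤∧≉⇒0< p x≉0 q = x≉0 (antisym q p)

  0<⇒≉ : ∀ {x} → 0# < x → ¬ x ≈ 0#
  0<⇒≉ p q = p (≤-reflexive q)

  *-positive : ∀ {x y} → 0# < x → 0# < y → 0# < x * y
  *-positive p q = 0≤∧≉⇒0< (*-nonNegative (<⇒≤ p) (<⇒≤ q)) (λ xy≈0 → 0<⇒≉ q (integral (0<⇒≉ p) xy≈0))

  *-cancel-nonNegative : ∀ {x y} → 0# < x → 0# ≤ x * y → 0# ≤ y
  *-cancel-nonNegative {x} {y} p q = ≮⇒≥ λ y<0 →
    *-positive p (0<y-x y<0)
      (≤-byDifference q (solve 2 (λ x y → :0 :- x :* (:0 :- y) := x :* y) refl x y))

  *-cancel-positive : ∀ {x y} → 0# < x → 0# < x * y → 0# < y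
  *-cancel-positive {x} {y} p q = 0≤∧≉⇒0< (*-cancel-nonNegative p (<⇒≤ q)) (λ y≈0 → 0<⇒≉ q (trans (*-congˡ y≈0) (zeroʳ x)))

  square-positive : ∀ {x} → ¬ x ≈ 0# → 0# < x * x
  square-positive {x} x≉0 = 0≤∧≉⇒0< (square-nonNegative x) (λ p → x≉0 (square-zero p))

  0<1 : 0# < 1#
  0<1 p = square-positive 1≉0 (≤-resp (sym (*-identityʳ 1#)) refl p)

  0<2 : 0# < 2#
  0<2 = +-positiveˡ 0<1 (<⇒≤ 0<1)

  inverse-positive : ∀ {x y} → 0# < x → x * y ≈ 1# → 0# < y
  inverse-positive p xy≈1 = *-cancel-positive p (λ q → 0<1 (≤-resp xy≈1 refl q))

  squareSum-zeroˡ : ∀ {x y} → x * x + y * y ≈ 0# → x ≈ 0#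
  squareSum-zeroˡ {x} {y} p with em {x ≈ 0#}
  ... | yes x≈0 = x≈0
  ... | no x≉0  = ⊥-elim (0<⇒≉ (+-positiveˡ (square-positive x≉0) (square-nonNegative y)) p)

  squareSum-zeroʳ : ∀ {x y} → x * x + y * y ≈ 0# → y ≈ 0#
  squareSum-zeroʳ p = squareSum-zeroˡ (trans (+-comm _ _) p)

  -- Only `y` needs a sign: if y < x, then x is positive as well, and x² - y² = (x - y)(x + y) is
  -- positive.
  square-cancel-≤ : ∀ {x y} → 0# ≤ y → x * x ≤ y * y → x ≤ y
  square-cancel-≤ {x} {y} 0≤y xx≤yy = ≮⇒≥ λ y<x →
    <-byDifference (*-positive (0<y-x y<x)
                               (+-positiveˡ (λ x≤0 → y<x (≤-trans x≤0 0≤y)) 0≤y))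
      (solve 2 (λ x y → x :* x :- y :* y := (x :- y) :* (x :+ y)) refl x y) xx≤yy

  -- For t > 0, t² + d ≥ 2t√d; so 2dt / (t² + d) is a lower and (t² + d) / 2t
  -- an upper estimate of √d.  At t = sup { x | x² ≤ d } they give both inequalities.
  sqrt-lower : ∀ {d t} w → 0# < d → (t * t + d) * w ≈ 1# → (2# * d * t * w) * (2# * d * t * w) ≤ d
  sqrt-lower {d} {t} w 0<d eq =
    ≤-byDifference (*-nonNegative (<⇒≤ 0<d) (square-nonNegative ((t * t - d) * w)))
      (trans (+-congʳ (trans (sym (trans (*-congˡ (*-identityʳ 1#)) (*-identityʳ d)))
                             (*-congˡ (*-cong (sym eq) (sym eq)))))
        (solve 3 (λ d t w → d :* (((t :* t :+ d) :* w) :* ((t :* t :+ d) :* w)) :- (:2 :* d :* t :* w) :* (:2 :* d :* t :* w)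
                          := d :* (((t :* t :- d) :* w) :* ((t :* t :- d) :* w))) refl d t w))

  sqrt-upper : ∀ {d t} w → (2# * t) * w ≈ 1# → d ≤ ((t * t + d) * w) * ((t * t + d) * w)
  sqrt-upper {d} {t} w eq =
    ≤-byDifference (square-nonNegative ((t * t - d) * w))
      (trans (+-congˡ (-‿cong (trans (sym (trans (*-congˡ (*-identityʳ 1#)) (*-identityʳ d)))
                                     (*-congˡ (*-cong (sym eq) (sym eq))))))
        (solve 3 (λ d t w → (t :* t :+ d) :* w :* ((t :* t :+ d) :* w) :- d :* (((:2 :* t) :* w) :* ((:2 :* t) :* w))
                          := ((t :* t :- d) :* w) :* ((t :* t :- d) :* w)) refl d t w))

  sqrt : ∀ d → 0# < d → ∃[ s ] (0# < s × s * s ≈ d)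
  sqrt d 0<d = fromSupremum (supremum S (0# , ≤-resp (sym (zeroˡ 0#)) refl (<⇒≤ 0<d)) (1# + d , bound))
    where
    S : Carrier → Set
    S x = x * x ≤ d

    -- The bound works because (1 + d)² - d = 1 + d + d² is nonnegative.
    bound : ∀ x → S x → x ≤ 1# + d
    bound x xx≤d = square-cancel-≤ (+-nonNegative (<⇒≤ 0<1) (<⇒≤ 0<d))
      (≤-trans xx≤d (≤-byDifference (+-nonNegative (+-nonNegative (<⇒≤ 0<1) (<⇒≤ 0<d)) (square-nonNegative d))
        (solve 1 (λ d → (:1 :+ d) :* (:1 :+ d) :- d := (:1 :+ d) :+ d :* d) refl d)))

    fromSupremum : ∃[ s ] ((∀ x → S x → x ≤ s) × (∀ b → (∀ x → S x → x ≤ b) → s ≤ b)) →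
                   ∃[ s ] (0# < s × s * s ≈ d)
    fromSupremum (s , upper , least) = s , 0<s , antisym ss≤d d≤ss
      where
      -- The lower estimate 2dt / (t² + d) lies in `S`, hence below the supremum; the inequality is
      -- cleared of its denominator.
      lowerEstimate≤s : ∀ t → 0# < t → 2# * d * t ≤ (t * t + d) * s
      lowerEstimate≤s t 0<t = let w , eq = inverse (t * t + d) (0<⇒≉ (+-positiveʳ (square-nonNegative t) 0<d)) in
        ≤-byDifference
        (*-nonNegative (+-nonNegative (square-nonNegative t) (<⇒≤ 0<d)) (0≤y-x (upper _ (sqrt-lower w 0<d eq))))
        (trans (+-congˡ (-‿cong (trans (sym (*-identityʳ _)) (*-congˡ (sym eq)))))
          (solve 4 (λ u v w s → u :* s :- v :* (u :* w) := u :* (s :- v :* w)) refl (t * t + d) (2# * d * t) w s))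

      -- At t = 1 the estimate reads 2d ≤ (1 + d) s, which forces s to be positive.
      0<s : 0# < s
      0<s = *-cancel-positive (+-positiveʳ (square-nonNegative 1#) 0<d)
        (λ q → *-positive (*-positive 0<2 0<d) 0<1 (≤-trans (lowerEstimate≤s 1# 0<1) q))

      d≤ss : d ≤ s * s
      d≤ss = ≮⇒≥ λ ss<d → *-positive 0<s (0<y-x ss<d)
        (≤-byDifference (0≤y-x (lowerEstimate≤s s 0<s))
          (solve 2 (λ d s → :0 :- s :* (d :- s :* s) := (s :* s :+ d) :* s :- :2 :* d :* s) refl d s))

      -- Leastness enters here: (s² + d) / 2s bounds `S` from above, so it is at least s, and this
      -- says s² ≤ d.
      ss≤d : s * s ≤ d
      ss≤d = let w , eq = inverse (2# * s) (0<⇒≉ (*-positive 0<2 0<s)) in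
        upper⇒ss≤d w eq (inverse-positive (*-positive 0<2 0<s) eq)
        where
        upper⇒ss≤d : ∀ w → (2# * s) * w ≈ 1# → 0# < w → s * s ≤ d
        upper⇒ss≤d w eq 0<w = ≮⇒≥ λ d<ss → *-positive 0<w (0<y-x d<ss)
          (≤-byDifference (0≤y-x (least _ upperEstimate))
            (trans (solve 3 (λ d s w → :0 :- w :* (s :* s :- d)
                  := (s :* s :+ d) :* w :- s :* ((:2 :* s) :* w)) refl d s w)
              (+-congˡ (-‿cong (trans (*-congˡ eq) (*-identityʳ s))))))
          where
          upperEstimate : ∀ x → S x → x ≤ (s * s + d) * w
          upperEstimate x xx≤d = square-cancel-≤
            (*-nonNegative (+-nonNegative (square-nonNegative s) (<⇒≤ 0<d)) (<⇒≤ 0<w))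
            (≤-trans xx≤d (sqrt-upper w eq))

-- Repetition-free lists and least natural numbers.

module _ {a ℓ} (S : Setoid a ℓ) where
  open Setoid S
  open Membership S using () renaming (_∈_ to _∈ˡ_)
  open Unique S using (Unique)
  open Permutation S using (_↭_; prep; ↭-sym; ↭-trans; ↭-reflexive-≋; ↭-refl)

  -- The head of `xs` is located in `ys` and moved to the front. As neither list repeats it, the
  -- remainders again have the same elements, and induction applies.
  unique⇒↭ : ∀ {xs ys} → Unique xs → Unique ys →
             (∀ {z} → z ∈ˡ xs → z ∈ˡ ys) → (∀ {z} → z ∈ˡ ys → z ∈ˡ xs) → xs ↭ ys
  unique⇒↭ {[]}     {[]}     _ _ _ _ = ↭-refl
  unique⇒↭ {[]}     {y ∷ ys} _ _ _ ys⊆xs with () ← ys⊆xs (here refl)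
  unique⇒↭ {x ∷ xs} {ys} (x∉xs ∷ xs!) ys! xs⊆ys ys⊆xs
    with as , bs , w , x≈w , ys≋ ← Membershipₚ.∈-∃++ S (xs⊆ys (here refl))
    with ys↭ ← ↭-trans (↭-reflexive-≋ ys≋) (Permutationₚ.shift S refl as bs)
    with w∉ ∷ rest! ← Permutationₚ.Unique-resp-↭ S ys↭ ys!
    = ↭-trans (prep x≈w (unique⇒↭ xs! rest! xs⊆rest rest⊆xs)) (↭-sym ys↭)
    where
    xs⊆rest : ∀ {z} → z ∈ˡ xs → z ∈ˡ as ++ bs
    xs⊆rest z∈xs with Permutationₚ.∈-resp-↭ S ys↭ (xs⊆ys (there z∈xs))
    ... | here z≈w  = ⊥-elim (All.lookupₛ S (λ p q r → q (trans r (sym p))) x∉xs z∈xs (trans x≈w (sym z≈w)))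
    ... | there z∈  = z∈
    rest⊆xs : ∀ {z} → z ∈ˡ as ++ bs → z ∈ˡ xs
    rest⊆xs z∈ with ys⊆xs (Permutationₚ.∈-resp-↭ S (↭-sym ys↭) (there z∈))
    ... | here z≈x  = ⊥-elim (All.lookupₛ S (λ p q r → q (trans r (sym p))) w∉ z∈ (sym (trans z≈x x≈w)))
    ... | there z∈xs = z∈xs

module _ (em : ExcludedMiddle 0ℓ) where

  least : ∀ (P : ℕ → Set) n → P n → ∃[ m ] (P m × ∀ k → k ℕ.< m → ¬ P k)
  least P = <-rec (λ n → P n → ∃[ m ] (P m × ∀ k → k ℕ.< m → ¬ P k)) λ n rec Pn → case rec Pn em
    where
    case : ∀ {n} → (∀ {k} → k ℕ.< n → P k → ∃[ m ] (P m × ∀ k → k ℕ.< m → ¬ P k)) → P n →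
           Dec (∃[ k ] (k ℕ.< n × P k)) → ∃[ m ] (P m × ∀ k → k ℕ.< m → ¬ P k)
    case rec Pn (yes (k , k<n , Pk)) = rec k<n Pk
    case rec Pn (no ¬smaller)        = _ , Pn , λ k k<n Pk → ¬smaller (k , k<n , Pk)

-- Finite subgroups of an arbitrary group: sums over them, orders, maxima and conjugates.

module FiniteSubgroups (em : ExcludedMiddle 0ℓ) (𝔾 : Group 0ℓ 0ℓ) where
  open Group 𝔾
  open Subgroups 𝔾 using (IsSubgroup; Finite; conjugate; ⟨_⟩; gen; unit; mul; inv; resp)
  open Membership setoid using () renaming (_∈_ to _∈ˡ_)
  open Unique setoid using (Unique)
  open Algebra.Properties.Group 𝔾 using (∙-cancelʳ; identityʳ-unique; ⁻¹-anti-homo-∙)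
  open Algebra.Properties.Monoid.Mult monoid public using () renaming (_×_ to power; ×-homo-+ to power-+)
  open Relation.Binary.Reasoning.Setoid setoid

  -- Repetitions are removed so that a sum over the list counts each group element exactly once.
  enumeration : ∀ {H : Pred Carrier 0ℓ} → Finite H → Σ[ xs ∈ List Carrier ] (Unique xs × H ≐ (_∈ˡ xs))
  enumeration (xs , H⊆xs , xs⊆H) =
    deduplicate _≟_ xs , UniqueDec.deduplicate-! decSetoid xs ,
    (λ x∈H → Membershipₚ.∈-deduplicate⁺ setoid _≟_ (λ p q → trans q (sym p)) (H⊆xs x∈H)) ,
    (λ x∈ → xs⊆H (Membershipₚ.∈-deduplicate⁻ setoid _≟_ xs x∈))
    where
    _≟_ : ∀ x y → Dec (x ≈ y)
    x ≟ y = em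
    decSetoid = record { isDecEquivalence = record { isEquivalence = isEquivalence ; _≟_ = _≟_ } }

  module _ (M : CommutativeMonoid 0ℓ 0ℓ) where
    private module M = CommutativeMonoid M

    fold : (Carrier → M.Carrier) → List Carrier → M.Carrier
    fold f []       = M.ε
    fold f (x ∷ xs) = f x M.∙ fold f xs

    fold-↭ : ∀ {f} → (∀ {x y} → x ≈ y → f x M.≈ f y) → ∀ {xs ys} → Permutation._↭_ setoid xs ys → fold f xs M.≈ fold f ys
    fold-↭ {f} f-cong {xs} {ys} p = M.trans (foldr-map xs) (M.trans
      (Permutationₚ.foldr-commMonoid M.setoid M.isCommutativeMonoid (Permutationₚ.map⁺ setoid M.setoid f-cong p))
      (M.sym (foldr-map ys)))
      where
      foldr-map : ∀ xs → fold f xs M.≈ foldr M._∙_ M.ε (map f xs)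
      foldr-map []       = M.refl
      foldr-map (x ∷ xs) = M.∙-congˡ (foldr-map xs)

    fold-map : ∀ {f h} xs → fold f (map h xs) M.≈ fold (λ x → f (h x)) xs
    fold-map []       = M.refl
    fold-map (x ∷ xs) = M.∙-congˡ (fold-map xs)

    -- Right translation by `h` is injective and maps `H` onto itself, so it only reorders a
    -- repetition-free list of `H`. This is what makes a sum over the group invariant.
    fold-translate : ∀ {H xs} → IsSubgroup {0ℓ} H → Unique xs → H ≐ (_∈ˡ xs) →
                     ∀ {f} → (∀ {x y} → x ≈ y → f x M.≈ f y) →
                     ∀ {h} → h ∈ H → fold (λ x → f (x ∙ h)) xs M.≈ fold f xs
    fold-translate {H} {xs} H≤ xs! (H⊆xs , xs⊆H) {f} f-cong {h} h∈H =
      M.trans (M.sym (fold-map xs)) (fold-↭ f-cong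
        (unique⇒↭ setoid (Uniqueₚ.map⁺ setoid setoid (∙-cancelʳ h _ _) xs!) xs! translate⊆xs xs⊆translate))
      where
      open IsSubgroup H≤ renaming (resp to H-resp)
      translate⊆xs : ∀ {z} → z ∈ˡ map (_∙ h) xs → z ∈ˡ xs
      translate⊆xs z∈ with x , x∈xs , z≈ ← Membershipₚ.∈-map⁻ setoid setoid z∈ =
        H⊆xs (H-resp (sym z≈) (∙-closed (xs⊆H x∈xs) h∈H))
      xs⊆translate : ∀ {z} → z ∈ˡ xs → z ∈ˡ map (_∙ h) xs
      xs⊆translate {z} z∈ = Membershipₚ.∈-resp-≈ setoid
        (trans (assoc z (h ⁻¹) h) (trans (∙-congˡ (inverseˡ h)) (identityʳ z)))
        (Membershipₚ.∈-map⁺ setoid setoid ∙-congʳ (H⊆xs (∙-closed (xs⊆H z∈) (⁻¹-closed h∈H))))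

  unconjugate : ∀ k x → k ⁻¹ ∙ (k ∙ x ∙ k ⁻¹) ∙ k ≈ x
  unconjugate k x = begin
    k ⁻¹ ∙ (k ∙ x ∙ k ⁻¹) ∙ k          ≈⟨ ∙-congʳ (assoc _ _ _) ⟨
    k ⁻¹ ∙ (k ∙ x) ∙ k ⁻¹ ∙ k          ≈⟨ assoc _ _ _ ⟩
    k ⁻¹ ∙ (k ∙ x) ∙ (k ⁻¹ ∙ k)        ≈⟨ trans (∙-congˡ (inverseˡ k)) (identityʳ _) ⟩
    k ⁻¹ ∙ (k ∙ x)                     ≈⟨ assoc _ _ _ ⟨
    k ⁻¹ ∙ k ∙ x                       ≈⟨ trans (∙-congʳ (inverseˡ k)) (identityˡ x) ⟩
    x                                  ∎

  reconjugate : ∀ k x → k ∙ (k ⁻¹ ∙ x ∙ k) ∙ k ⁻¹ ≈ x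
  reconjugate k x = begin
    k ∙ (k ⁻¹ ∙ x ∙ k) ∙ k ⁻¹      ≈⟨ assoc _ _ _ ⟩
    k ∙ (k ⁻¹ ∙ x ∙ k ∙ k ⁻¹)      ≈⟨ ∙-congˡ (assoc _ _ _) ⟩
    k ∙ (k ⁻¹ ∙ x ∙ (k ∙ k ⁻¹))    ≈⟨ ∙-congˡ (trans (∙-congˡ (inverseʳ k)) (identityʳ _)) ⟩
    k ∙ (k ⁻¹ ∙ x)                 ≈⟨ assoc _ _ _ ⟨
    k ∙ k ⁻¹ ∙ x                   ≈⟨ trans (∙-congʳ (inverseʳ k)) (identityˡ x) ⟩
    x                              ∎

  power-difference : ∀ {g i j} → i ℕ.≤ j → power i g ≈ power j g → power (j ℕ.∸ i) g ≈ ε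
  power-difference {g} {i} {j} i≤j eq = identityʳ-unique (power i g) _ (begin
    power i g ∙ power (j ℕ.∸ i) g   ≈⟨ power-+ g i (j ℕ.∸ i) ⟨
    power (i ℕ.+ (j ℕ.∸ i)) g       ≡⟨ ≡.cong (λ k → power k g) (ℕ.m+[n∸m]≡n i≤j) ⟩
    power j g                       ≈⟨ eq ⟨
    power i g                       ∎)

  power-periodic : ∀ n g → power n g ≈ ε → ∀ k → power (n ℕ.+ k) g ≈ power k g
  power-periodic n g gⁿ≈ε k = begin
    power (n ℕ.+ k) g       ≈⟨ power-+ g n k ⟩
    power n g ∙ power k g   ≈⟨ ∙-congʳ gⁿ≈ε ⟩
    ε ∙ power k g           ≈⟨ identityˡ _ ⟩
    power k g               ∎

  power-injective : ∀ n g → (∀ m → m ℕ.< n → ¬ (0 ℕ.< m × power m g ≈ ε)) →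
                    ∀ {j k} → j ℕ.< n → k ℕ.< n → power j g ≈ power k g → j ≡ k
  power-injective n g minimal {j} {k} j<n k<n eq with ℕ.<-cmp j k
  ... | tri< j<k _ _ = ⊥-elim (minimal (k ℕ.∸ j) (ℕ.≤-<-trans (ℕ.m∸n≤m k j) k<n)
                         (ℕ.m<n⇒0<n∸m j<k , power-difference (ℕ.<⇒≤ j<k) eq))
  ... | tri≈ _ j≡k _ = j≡k
  ... | tri> _ _ k<j = ⊥-elim (minimal (j ℕ.∸ k) (ℕ.≤-<-trans (ℕ.m∸n≤m j k) j<n)
                         (ℕ.m<n⇒0<n∸m k<j , power-difference (ℕ.<⇒≤ k<j) (sym eq)))

  module _ {H : Pred Carrier 0ℓ} (H≤ : IsSubgroup H) where
    open IsSubgroup H≤ renaming (resp to H-resp)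

    power-closed : ∀ {g} → g ∈ H → ∀ n → power n g ∈ H
    power-closed g∈H zero    = ε-closed
    power-closed g∈H (suc n) = ∙-closed g∈H (power-closed g∈H n)

    -- Among `length xs + 1` powers of `g` two occupy the same position in the list. The difference
    -- of their exponents is a positive exponent that kills `g`, and the least such exponent exists.
    order : Finite H → ∀ {g} → g ∈ H →
            ∃[ n ] ((0 ℕ.< n × power n g ≈ ε) × ∀ m → m ℕ.< n → ¬ (0 ℕ.< m × power m g ≈ ε))
    order (xs , H⊆xs , _) {g} g∈H
      with i , j , i<j , eq ← pigeonhole (ℕ.n<1+n (length xs)) (λ i → Any.index (H⊆xs (power-closed g∈H (toℕ i))))
      = least em (λ n → 0 ℕ.< n × power n g ≈ ε) (toℕ j ℕ.∸ toℕ i)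
          (ℕ.m<n⇒0<n∸m i<j , power-difference (ℕ.<⇒≤ i<j) (Membershipₚ.index-injective setoid _ _ eq))

    conjugate-isSubgroup : ∀ k → IsSubgroup (conjugate k H)
    conjugate-isSubgroup k = record
      { resp      = λ x≈y → H-resp (∙-congʳ (∙-congˡ x≈y))
      ; ε-closed  = H-resp (sym (trans (∙-congʳ (identityʳ (k ⁻¹))) (inverseˡ k))) ε-closed
      ; ∙-closed  = λ {x} {y} x∈ y∈ → H-resp (begin
          k ⁻¹ ∙ x ∙ k ∙ (k ⁻¹ ∙ y ∙ k)      ≈⟨ assoc _ _ _ ⟩
          k ⁻¹ ∙ x ∙ (k ∙ (k ⁻¹ ∙ y ∙ k))    ≈⟨ ∙-congˡ (assoc _ _ _) ⟨
          k ⁻¹ ∙ x ∙ (k ∙ (k ⁻¹ ∙ y) ∙ k)    ≈⟨ ∙-congˡ (∙-congʳ (assoc _ _ _)) ⟨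
          k ⁻¹ ∙ x ∙ (k ∙ k ⁻¹ ∙ y ∙ k)      ≈⟨ ∙-congˡ (∙-congʳ (trans (∙-congʳ (inverseʳ k)) (identityˡ y))) ⟩
          k ⁻¹ ∙ x ∙ (y ∙ k)                 ≈⟨ assoc _ _ _ ⟨
          k ⁻¹ ∙ x ∙ y ∙ k                   ≈⟨ ∙-congʳ (assoc _ _ _) ⟩
          k ⁻¹ ∙ (x ∙ y) ∙ k                 ∎) (∙-closed x∈ y∈)
      ; ⁻¹-closed = λ {x} x∈ → H-resp (begin
          (k ⁻¹ ∙ x ∙ k) ⁻¹                  ≈⟨ ⁻¹-anti-homo-∙ _ _ ⟩
          k ⁻¹ ∙ (k ⁻¹ ∙ x) ⁻¹               ≈⟨ ∙-congˡ (⁻¹-anti-homo-∙ _ _) ⟩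
          k ⁻¹ ∙ (x ⁻¹ ∙ k ⁻¹ ⁻¹)            ≈⟨ ∙-congˡ (∙-congˡ (⁻¹-involutive k)) ⟩
          k ⁻¹ ∙ (x ⁻¹ ∙ k)                  ≈⟨ assoc _ _ _ ⟨
          k ⁻¹ ∙ x ⁻¹ ∙ k                    ∎) (⁻¹-closed x∈)
      }
      where open Algebra.Properties.Group 𝔾 using (⁻¹-involutive)

    conjugate-finite : Finite H → ∀ k → Finite (conjugate k H)
    conjugate-finite (xs , H⊆xs , xs⊆H) k = map (λ x → k ∙ x ∙ k ⁻¹) xs , to , from
      where
      to : ∀ {x} → x ∈ conjugate k H → x ∈ˡ map (λ x → k ∙ x ∙ k ⁻¹) xs
      to {x} x∈ = Membershipₚ.∈-resp-≈ setoid (reconjugate k x)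
        (Membershipₚ.∈-map⁺ setoid setoid (λ p → ∙-congʳ (∙-congˡ p)) (H⊆xs x∈))
      from : ∀ {x} → x ∈ˡ map (λ x → k ∙ x ∙ k ⁻¹) xs → x ∈ conjugate k H
      from {x} x∈ with y , y∈xs , x≈ ← Membershipₚ.∈-map⁻ setoid setoid x∈ =
        H-resp (sym (trans (∙-congʳ (∙-congˡ x≈)) (unconjugate k y))) (xs⊆H y∈xs)

    module _ (T : TotalOrder 0ℓ 0ℓ 0ℓ) (f : Carrier → TotalOrder.Carrier T)
             (f-cong : ∀ {x y} → x ≈ y → TotalOrder._≈_ T (f x) (f y)) where
      private module T = TotalOrder T
      open T using (_≤_)

      -- The running candidate `w` is the answer for the empty list. The extra inequality between
      -- `f w` and `f m` lets entries discarded earlier be compared with the final maximum.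
      maximum-list : ∀ (P : Pred Carrier 0ℓ) → (∀ {x y} → x ≈ y → x ∈ P → y ∈ P) →
                     ∀ xs {w} → w ∈ P → ∃[ m ] (m ∈ P × f w ≤ f m × (∀ {z} → z ∈ˡ xs → z ∈ P → f z ≤ f m))
      maximum-list P P-resp []       {w} w∈P = w , w∈P , T.refl , λ ()
      maximum-list P P-resp (x ∷ xs) {w} w∈P with em {x ∈ P × f w ≤ f x}
      ... | yes (x∈P , fw≤fx) with m , m∈P , fx≤fm , max ← maximum-list P P-resp xs x∈P =
        m , m∈P , T.trans fw≤fx fx≤fm , λ
          { (here z≈x) _  → T.trans (T.reflexive (f-cong z≈x)) fx≤fm
          ; (there z∈) z∈P → max z∈ z∈P }
      ... | no ¬larger with m , m∈P , fw≤fm , max ← maximum-list P P-resp xs w∈P =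
        m , m∈P , fw≤fm , λ
          { (here z≈x) z∈P → T.trans (T.reflexive (f-cong z≈x)) (T.trans (smaller (P-resp z≈x z∈P)) fw≤fm)
          ; (there z∈) z∈P → max z∈ z∈P }
        where
        smaller : x ∈ P → f x ≤ f w
        smaller x∈P with T.total (f w) (f x)
        ... | inj₁ fw≤fx = ⊥-elim (¬larger (x∈P , fw≤fx))
        ... | inj₂ fx≤fw = fx≤fw

      maximum : Finite H → ∀ (P : Pred Carrier 0ℓ) → (∀ {x y} → x ≈ y → x ∈ P → y ∈ P) → P ⊆ H →
                ∀ {w} → w ∈ P → ∃[ m ] (m ∈ P × (∀ z → z ∈ P → f z ≤ f m))
      maximum (xs , H⊆xs , _) P P-resp P⊆H w∈P with m , m∈P , _ , max ← maximum-list P P-resp xs w∈P =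
        m , m∈P , λ z z∈P → max (H⊆xs (P⊆H z∈P)) z∈P

      -- Apply the hypothesis to an element of the coset h⟨g⟩ with maximal f: it must be ε.
      generated-by : Finite H → ∀ {g} → g ∈ H →
                     (∀ u → u ∈ H → ¬ u ≈ ε → ¬ f (u ∙ g) ≤ f u ⊎ ¬ f (u ∙ g ⁻¹) ≤ f u) →
                     ∀ {h} → h ∈ H → ∃[ k ] power k g ≈ h
      generated-by finite {g} g∈H increase {h} h∈H = fromOrder (order finite g∈H)
        where
        Coset : Pred Carrier 0ℓ
        Coset z = z ∈ H × ∃[ k ] z ∙ power k g ≈ h

        fromOrder : ∃[ n ] ((0 ℕ.< n × power n g ≈ ε) × ∀ m → m ℕ.< n → ¬ (0 ℕ.< m × power m g ≈ ε)) →
                    ∃[ k ] power k g ≈ h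
        fromOrder (suc n , (_ , gⁿ⁺¹≈ε) , _) = fromMaximum (maximum finite Coset
          (λ { x≈y (x∈H , k , eq) → H-resp x≈y x∈H , k , trans (∙-congʳ (sym x≈y)) eq }) proj₁
          {h} (h∈H , 0 , identityʳ h))
          where
          fromMaximum : ∃[ m ] (m ∈ Coset × (∀ z → z ∈ Coset → f z ≤ f m)) → ∃[ k ] power k g ≈ h
          fromMaximum (m , (m∈H , k , eq) , max) with em {m ≈ ε}
          ... | yes m≈ε = k , (begin
            power k g        ≈⟨ identityˡ _ ⟨
            ε ∙ power k g    ≈⟨ ∙-congʳ m≈ε ⟨
            m ∙ power k g    ≈⟨ eq ⟩
            h                ∎)
          ... | no m≉ε with increase m m∈H m≉ε
          -- Exponents are natural numbers, so g⁻¹ has to appear as a power: since g^(n+1) = 1, it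
          -- is `power n g`, and the exponent for `m ∙ g` is n + k.
          ...   | inj₁ larger = ⊥-elim (larger (max (m ∙ g) (∙-closed m∈H g∈H , n ℕ.+ k , (begin
            m ∙ g ∙ power (n ℕ.+ k) g            ≈⟨ assoc m g _ ⟩
            m ∙ power (suc n ℕ.+ k) g            ≈⟨ ∙-congˡ (power-periodic (suc n) g gⁿ⁺¹≈ε k) ⟩
            m ∙ power k g                        ≈⟨ eq ⟩
            h                                    ∎))))
          ...   | inj₂ larger = ⊥-elim (larger (max (m ∙ g ⁻¹) (∙-closed m∈H (⁻¹-closed g∈H) , suc k , (begin
            m ∙ g ⁻¹ ∙ (g ∙ power k g)           ≈⟨ assoc m (g ⁻¹) _ ⟩
            m ∙ (g ⁻¹ ∙ (g ∙ power k g))         ≈⟨ ∙-congˡ (assoc _ _ _) ⟨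
            m ∙ (g ⁻¹ ∙ g ∙ power k g)           ≈⟨ ∙-congˡ (trans (∙-congʳ (inverseˡ g)) (identityˡ _)) ⟩
            m ∙ power k g                        ≈⟨ eq ⟩
            h                                    ∎))))

    generated-least : ∀ {S : Pred Carrier 0ℓ} → S ⊆ H → ⟨ S ⟩ ⊆ H
    generated-least S⊆H (gen x∈)       = S⊆H x∈
    generated-least S⊆H unit           = ε-closed
    generated-least S⊆H (mul x∈ y∈)    = ∙-closed (generated-least S⊆H x∈) (generated-least S⊆H y∈)
    generated-least S⊆H (inv x∈)       = ⁻¹-closed (generated-least S⊆H x∈)
    generated-least S⊆H (resp x≈y x∈)  = H-resp x≈y (generated-least S⊆H x∈)

  conjugate-≈ε : ∀ k x → k ∙ x ∙ k ⁻¹ ≈ ε → x ≈ ε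
  conjugate-≈ε k x eq = begin
    x                            ≈⟨ unconjugate k x ⟨
    k ⁻¹ ∙ (k ∙ x ∙ k ⁻¹) ∙ k    ≈⟨ ∙-congʳ (∙-congˡ eq) ⟩
    k ⁻¹ ∙ ε ∙ k                 ≈⟨ ∙-congʳ (identityʳ (k ⁻¹)) ⟩
    k ⁻¹ ∙ k                     ≈⟨ inverseˡ k ⟩
    ε                            ∎

  power-generated : ∀ {S : Pred Carrier 0ℓ} {g} → g ∈ S → ∀ n → power n g ∈ ⟨ S ⟩
  power-generated g∈S zero    = unit
  power-generated g∈S (suc n) = mul (gen g∈S) (power-generated g∈S n)

-- Plane linear algebra: determinant, trace and fixed spaces.

module PlaneGeometry (em : ExcludedMiddle 0ℓ) (ℝ : CompleteOrderedField) where
  open Plane ℝ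
  open OrderedField em ℝ
  open CompleteOrderedField ℝ using (inverse; 1≉0)
  open IntegerCoefficients (CompleteOrderedField.commutativeRing ℝ)
  open CommutativeRing (CompleteOrderedField.commutativeRing ℝ)
    using (refl; sym; trans; +-cong; +-congˡ; +-congʳ; *-cong; *-congˡ; *-congʳ; -‿cong;
      *-identityʳ; +-identityˡ; -‿inverseʳ; setoid)
  open Group GL₂-group using (_∙_; ε; _⁻¹)
  open FiniteSubgroups em GL₂-group
  open Relation.Binary.Reasoning.Setoid setoid

  pattern i₀ = zero
  pattern i₁ = suc zero

  -≈0⇒≈ : ∀ {x y} → x - y ≈ 0# → x ≈ y
  -≈0⇒≈ {x} {y} p = begin
    x            ≈⟨ solve 2 (λ x y → x := (x :- y) :+ y) refl x y ⟩
    (x - y) + y  ≈⟨ +-congʳ p ⟩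
    0# + y       ≈⟨ +-identityˡ y ⟩
    y            ∎

  ≈⇒-≈0 : ∀ {x y} → x ≈ y → x - y ≈ 0#
  ≈⇒-≈0 {x} {y} p = trans (+-congʳ p) (-‿inverseʳ y)

  det tr : Matrix → Carrier
  det A = A i₀ i₀ * A i₁ i₁ - A i₀ i₁ * A i₁ i₀
  tr A = A i₀ i₀ + A i₁ i₁

  det-cong : ∀ {A B} → A ≈ₘ B → det A ≈ det B
  det-cong p = +-cong (*-cong (p i₀ i₀) (p i₁ i₁)) (-‿cong (*-cong (p i₀ i₁) (p i₁ i₀)))

  tr-cong : ∀ {A B} → A ≈ₘ B → tr A ≈ tr B
  tr-cong p = +-cong (p i₀ i₀) (p i₁ i₁)

  det-· : ∀ A B → det (A · B) ≈ det A * det B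
  det-· A B = solve 8 (λ a b c d a′ b′ c′ d′ →
      (a :* a′ :+ b :* c′) :* (c :* b′ :+ d :* d′) :- (a :* b′ :+ b :* d′) :* (c :* a′ :+ d :* c′) :=
      (a :* d :- b :* c) :* (a′ :* d′ :- b′ :* c′)) refl
    (A i₀ i₀) (A i₀ i₁) (A i₁ i₀) (A i₁ i₁) (B i₀ i₀) (B i₀ i₁) (B i₁ i₀) (B i₁ i₁)

  tr-comm : ∀ A B → tr (A · B) ≈ tr (B · A)
  tr-comm A B = solve 8 (λ a b c d a′ b′ c′ d′ →
      (a :* a′ :+ b :* c′) :+ (c :* b′ :+ d :* d′) := (a′ :* a :+ b′ :* c) :+ (c′ :* b :+ d′ :* d)) refl
    (A i₀ i₀) (A i₀ i₁) (A i₁ i₀) (A i₁ i₁) (B i₀ i₀) (B i₀ i₁) (B i₁ i₀) (B i₁ i₁)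

  det-I : det I ≈ 1#
  det-I = solve 0 (:1 :* :1 :- :0 :* :0 := :1) refl

  det-⁻¹ : ∀ k → det (mat k) * det (mat⁻¹ k) ≈ 1#
  det-⁻¹ k = trans (sym (det-· (mat k) (mat⁻¹ k))) (trans (det-cong {mat k · mat⁻¹ k} {I} (inverseʳ k)) det-I)

  det-conjugate : ∀ k x → det (mat ((k ⁻¹ ∙ x) ∙ k)) ≈ det (mat x)
  det-conjugate k x = begin
    det ((mat⁻¹ k · mat x) · mat k)                   ≈⟨ det-· (mat⁻¹ k · mat x) (mat k) ⟩
    det (mat⁻¹ k · mat x) * det (mat k)               ≈⟨ *-congʳ (det-· (mat⁻¹ k) (mat x)) ⟩
    (det (mat⁻¹ k) * det (mat x)) * det (mat k)       ≈⟨ solve 3 (λ a b c → (a :* b) :* c := b :* (c :* a)) refl _ _ _ ⟩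
    det (mat x) * (det (mat k) * det (mat⁻¹ k))       ≈⟨ *-congˡ (det-⁻¹ k) ⟩
    det (mat x) * 1#                                  ≈⟨ *-identityʳ _ ⟩
    det (mat x)                                       ∎

  tr-conjugate : ∀ k x → tr (mat ((k ⁻¹ ∙ x) ∙ k)) ≈ tr (mat x)
  tr-conjugate k x = begin
    tr ((mat⁻¹ k · mat x) · mat k)     ≈⟨ tr-comm (mat⁻¹ k · mat x) (mat k) ⟩
    tr (mat k · (mat⁻¹ k · mat x))     ≈⟨ tr-cong {mat k · (mat⁻¹ k · mat x)} {(mat k · mat⁻¹ k) · mat x} (λ i j → sym (assoc k (k ⁻¹) x i j)) ⟩
    tr ((mat k · mat⁻¹ k) · mat x)     ≈⟨ tr-cong {(mat k · mat⁻¹ k) · mat x} {I · mat x} (∙-congʳ {x} {k ∙ k ⁻¹} {ε} (inverseʳ k)) ⟩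
    tr (I · mat x)                     ≈⟨ tr-cong {I · mat x} {mat x} (identityˡ x) ⟩
    tr (mat x)                         ∎
    where open Group GL₂-group using (assoc; ∙-congʳ; identityˡ)

  Full : Pred V 0ℓ → Set
  Full W = ∀ v → v ∈ W

  dimension₁⇒nonzero : ∀ {W} → Dimension W 1 → ¬ W ⊆ Origin
  dimension₁⇒nonzero (b , basis) W⊆O = 1≉0 (independent (λ _ → 1#) (λ i → begin
      1# * b i₀ i + 0#   ≈⟨ +-congʳ (*-congˡ (W⊆O (member i₀) i)) ⟩
      1# * 0# + 0#       ≈⟨ solve 0 (:1 :* :0 :+ :0 := :0) refl ⟩
      0#                 ∎) i₀)
    where open IsBasis basis

  -- If both standard basis vectors were multiples of one vector, their determinant, which is 1,
  -- would vanish.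
  dimension₁⇒¬full : ∀ {W} → Dimension W 1 → ¬ Full W
  dimension₁⇒¬full (b , basis) full = impossible (spanning (full e₀)) (spanning (full e₁))
    where
    open IsBasis basis
    e₀ e₁ : V
    e₀ i₀ = 1#
    e₀ i₁ = 0#
    e₁ i₀ = 0#
    e₁ i₁ = 1#
    impossible : (∃[ c ] linearCombination c b ≈ᵥ e₀) → (∃[ c ] linearCombination c b ≈ᵥ e₁) → ⊥
    impossible (c , p) (c′ , q) = 1≉0 (begin
      1#                                                                  ≈⟨ solve 0 (:1 := :1 :* :1 :- :0 :* :0) refl ⟩
      1# * 1# - 0# * 0#                                                   ≈⟨ +-cong (*-cong (p i₀) (q i₁))
          (-‿cong (*-cong (p i₁) (q i₀))) ⟨
      (c i₀ * b i₀ i₀ + 0#) * (c′ i₀ * b i₀ i₁ + 0#) - (c i₀ * b i₀ i₁ + 0#) * (c′ i₀ * b i₀ i₀ + 0#)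
        ≈⟨ solve 4 (λ c c′ x y → (c :* x :+ :0) :* (c′ :* y :+ :0) :- (c :* y :+ :0) :* (c′ :* x :+ :0)
              := :0) refl (c i₀) (c′ i₀) (b i₀ i₀) (b i₀ i₁) ⟩
      0#                                                                  ∎)

  -- The line p x + q y = 0 is spanned by its normal (p , q) turned by a quarter turn. The
  -- coordinate of `v` is its inner product with that vector divided by p² + q², which is nonzero in
  -- an ordered field.
  line-dimension : ∀ {W} p q → ¬ (p ≈ 0# × q ≈ 0#) →
                   (∀ v → p * v i₀ + q * v i₁ ≈ 0# → v ∈ W) → (∀ v → v ∈ W → p * v i₀ + q * v i₁ ≈ 0#) →
                   Dimension W 1
  line-dimension {W} p q pq≉0 sufficient necessary = (λ _ → u) , record
    { member      = λ _ → sufficient u (solve 2 (λ p q → p :* (:- q) :+ q :* p := :0) refl p q)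
    ; independent = λ c eq → λ { i₀ → integral norm≉0 (begin
          (p * p + q * q) * c i₀
            ≈⟨ solve 3 (λ p q c → (p :* p :+ q :* q) :* c
                  := p :* (c :* p :+ :0) :- q :* (c :* (:- q) :+ :0)) refl p q (c i₀) ⟩
          p * (c i₀ * p + 0#) - q * (c i₀ * (- q) + 0#)
            ≈⟨ +-cong (*-congˡ (eq i₁)) (-‿cong (*-congˡ (eq i₀))) ⟩
          p * 0# - q * 0#
            ≈⟨ solve 2 (λ p q → p :* :0 :- q :* :0 := :0) refl p q ⟩
          0# ∎) }
    ; spanning    = λ {v} v∈W → (λ _ → (p * v i₁ - q * v i₀) * w) , λ
        { i₀ → begin
          ((p * v i₁ - q * v i₀) * w) * (- q) + 0#
            ≈⟨ solve 5 (λ p q w x y → ((p :* y :- q :* x) :* w) :* (:- q) :+ :0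
                 := x :* ((p :* p :+ q :* q) :* w) :- (p :* w) :* (p :* x :+ q :* y)) refl p q w (v i₀) (v i₁) ⟩
          v i₀ * ((p * p + q * q) * w) - (p * w) * (p * v i₀ + q * v i₁)
            ≈⟨ +-cong (*-congˡ norm*w≈1) (-‿cong (*-congˡ (necessary v v∈W))) ⟩
          v i₀ * 1# - (p * w) * 0#
            ≈⟨ solve 2 (λ x y → x :* :1 :- y :* :0 := x) refl (v i₀) (p * w) ⟩
          v i₀ ∎
        ; i₁ → begin
          ((p * v i₁ - q * v i₀) * w) * p + 0#
            ≈⟨ solve 5 (λ p q w x y → ((p :* y :- q :* x) :* w) :* p :+ :0
                 := y :* ((p :* p :+ q :* q) :* w) :- (q :* w) :* (p :* x :+ q :* y)) refl p q w (v i₀) (v i₁) ⟩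
          v i₁ * ((p * p + q * q) * w) - (q * w) * (p * v i₀ + q * v i₁)
            ≈⟨ +-cong (*-congˡ norm*w≈1) (-‿cong (*-congˡ (necessary v v∈W))) ⟩
          v i₁ * 1# - (q * w) * 0#
            ≈⟨ solve 2 (λ x y → x :* :1 :- y :* :0 := x) refl (v i₁) (q * w) ⟩
          v i₁ ∎ }
    }
    where
    u : V
    u i₀ = - q
    u i₁ = p
    norm≉0 : ¬ (p * p + q * q ≈ 0#)
    norm≉0 eq = pq≉0 (squareSum-zeroˡ eq , squareSum-zeroʳ eq)
    w : Carrier
    w = proj₁ (inverse _ norm≉0)
    norm*w≈1 : (p * p + q * q) * w ≈ 1#
    norm*w≈1 = proj₂ (inverse _ norm≉0)

  -- A vanishing determinant makes the second row a multiple of the nonzero first row. Rather than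
  -- naming the factor, the second form is multiplied by whichever of `p`, `q` is nonzero, which
  -- makes it a combination of the first form and the determinant.
  dependent-row : ∀ p q r s x y → ¬ (p ≈ 0# × q ≈ 0#) → p * s - q * r ≈ 0# →
                  p * x + q * y ≈ 0# → r * x + s * y ≈ 0#
  dependent-row p q r s x y pq≉0 singular eq with em {p ≈ 0#} | em {q ≈ 0#}
  ... | yes p≈0 | yes q≈0 = ⊥-elim (pq≉0 (p≈0 , q≈0))
  ... | no p≉0  | _       = integral p≉0 (begin
    p * (r * x + s * y)                        ≈⟨ solve 6 (λ p q r s x y → p :* (r :* x :+ s :* y)
          := r :* (p :* x :+ q :* y) :+ y :* (p :* s :- q :* r)) refl p q r s x y ⟩
    r * (p * x + q * y) + y * (p * s - q * r)  ≈⟨ +-cong (*-congˡ eq) (*-congˡ singular) ⟩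
    r * 0# + y * 0#                            ≈⟨ solve 2 (λ r y → r :* :0 :+ y :* :0 := :0) refl r y ⟩
    0#                                         ∎)
  ... | _       | no q≉0  = integral q≉0 (begin
    q * (r * x + s * y)                        ≈⟨ solve 6 (λ p q r s x y → q :* (r :* x :+ s :* y)
          := s :* (p :* x :+ q :* y) :- x :* (p :* s :- q :* r)) refl p q r s x y ⟩
    s * (p * x + q * y) - x * (p * s - q * r)  ≈⟨ +-cong (*-congˡ eq) (-‿cong (*-congˡ singular)) ⟩
    s * 0# - x * 0#                            ≈⟨ solve 2 (λ r y → r :* :0 :- y :* :0 := :0) refl s x ⟩
    0#                                         ∎)

  -- det (A - I)
  characteristic : Matrix → Carrier
  characteristic A = det A - tr A + 1#

  characteristic-rows : ∀ A → (A i₀ i₀ - 1#) * (A i₁ i₁ - 1#) - A i₀ i₁ * A i₁ i₀ ≈ characteristic A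
  characteristic-rows A = solve 4 (λ a b c d → (a :- :1) :* (d :- :1) :- b :* c
        := (a :* d :- b :* c) :- (a :+ d) :+ :1) refl
    (A i₀ i₀) (A i₀ i₁) (A i₁ i₀) (A i₁ i₁)

  module _ (g : GL₂) where
    private
      a b c d : Carrier
      a = mat g i₀ i₀
      b = mat g i₀ i₁
      c = mat g i₁ i₀
      d = mat g i₁ i₁

    row₀⇒ : ∀ {x y} → (a - 1#) * x + b * y ≈ 0# → a * x + b * y ≈ x
    row₀⇒ {x} {y} eq = -≈0⇒≈ (trans (solve 4 (λ a b x y → (a :* x :+ b :* y) :- x
          := (a :- :1) :* x :+ b :* y) refl a b x y) eq)

    row₀⇐ : ∀ {x y} → a * x + b * y ≈ x → (a - 1#) * x + b * y ≈ 0#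
    row₀⇐ {x} {y} eq = trans (solve 4 (λ a b x y → (a :- :1) :* x :+ b :* y
          := (a :* x :+ b :* y) :- x) refl a b x y) (≈⇒-≈0 eq)

    row₁⇒ : ∀ {x y} → c * x + (d - 1#) * y ≈ 0# → c * x + d * y ≈ y
    row₁⇒ {x} {y} eq = -≈0⇒≈ (trans (solve 4 (λ a b x y → (a :* x :+ b :* y) :- y
          := a :* x :+ (b :- :1) :* y) refl c d x y) eq)

    row₁⇐ : ∀ {x y} → c * x + d * y ≈ y → c * x + (d - 1#) * y ≈ 0#
    row₁⇐ {x} {y} eq = trans (solve 4 (λ a b x y → a :* x :+ (b :- :1) :* y
          := (a :* x :+ b :* y) :- y) refl c d x y) (≈⇒-≈0 eq)

    -- A - I is singular but nonzero, so it has a nonzero row. That row cuts out a line, on which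
    -- the other, dependent row vanishes too.
    singular⇒reflection : characteristic (mat g) ≈ 0# → ¬ (mat g ≈ₘ I) → Reflection g
    singular⇒reflection singular g≉I = 1 , dim , ≡.refl
      where
      singular₀ : (a - 1#) * (d - 1#) - b * c ≈ 0#
      singular₀ = trans (characteristic-rows (mat g)) singular
      singular₁ : (d - 1#) * (a - 1#) - c * b ≈ 0#
      singular₁ = trans (solve 4 (λ a b c d → d :* a :- c :* b
            := a :* d :- b :* c) refl (a - 1#) b c (d - 1#)) singular₀
      dim : Dimension (Fix g) 1
      dim with em {a - 1# ≈ 0# × b ≈ 0#} | em {c ≈ 0# × d - 1# ≈ 0#}
      ... | no row₀≉0 | _ = line-dimension (a - 1#) b row₀≉0
        (λ v eq → λ { i₀ → row₀⇒ eq ; i₁ → row₁⇒ (dependent-row (a - 1#) b c (d - 1#) (v i₀) (v i₁) row₀≉0 singular₀ eq) })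
        (λ v v∈ → row₀⇐ (v∈ i₀))
      ... | _ | no row₁≉0 = line-dimension c (d - 1#) row₁≉0
        (λ v eq → λ { i₀ → row₀⇒ (trans (solve 4 (λ a b x y → a :* x :+ b :* y
              := b :* y :+ a :* x) refl (a - 1#) b (v i₀) (v i₁))
                               (dependent-row (d - 1#) c b (a - 1#) (v i₁) (v i₀) (λ { (p , q) → row₁≉0 (q , p) }) singular₁
                                 (trans (solve 4 (λ a b x y → a :* x :+ b :* y
                                       := b :* y :+ a :* x) refl (d - 1#) c (v i₁) (v i₀)) eq)))
                    ; i₁ → row₁⇒ eq })
        (λ v v∈ → row₁⇐ (v∈ i₁))
      ... | yes (p , q) | yes (r , s) = ⊥-elim (g≉I λ
        { i₀ i₀ → -≈0⇒≈ p ; i₀ i₁ → q ; i₁ i₀ → r ; i₁ i₁ → -≈0⇒≈ s })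

    -- Cramer's rule for the system (A - I) v = 0.
    regular⇒Fix⊆Origin : ¬ (characteristic (mat g) ≈ 0#) → Fix g ⊆ Origin
    regular⇒Fix⊆Origin regular {v} v∈ = λ
      { i₀ → integral regular (begin
          characteristic (mat g) * v i₀
            ≈⟨ solve 6 (λ a b c d x y → ((a :* d :- b :* c) :- (a :+ d) :+ :1) :* x
                 := (d :- :1) :* ((a :- :1) :* x :+ b :* y) :- b :* (c :* x :+ (d :- :1) :* y)) refl a b c d (v i₀) (v i₁) ⟩
          (d - 1#) * ((a - 1#) * v i₀ + b * v i₁) - b * (c * v i₀ + (d - 1#) * v i₁)
            ≈⟨ +-cong (*-congˡ (row₀⇐ (v∈ i₀))) (-‿cong (*-congˡ (row₁⇐ (v∈ i₁)))) ⟩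
          (d - 1#) * 0# - b * 0#
            ≈⟨ solve 2 (λ x y → x :* :0 :- y :* :0 := :0) refl (d - 1#) b ⟩
          0# ∎)
      ; i₁ → integral regular (begin
          characteristic (mat g) * v i₁
            ≈⟨ solve 6 (λ a b c d x y → ((a :* d :- b :* c) :- (a :+ d) :+ :1) :* y
                 := (a :- :1) :* (c :* x :+ (d :- :1) :* y) :- c :* ((a :- :1) :* x :+ b :* y)) refl a b c d (v i₀) (v i₁) ⟩
          (a - 1#) * (c * v i₀ + (d - 1#) * v i₁) - c * ((a - 1#) * v i₀ + b * v i₁)
            ≈⟨ +-cong (*-congˡ (row₁⇐ (v∈ i₁))) (-‿cong (*-congˡ (row₀⇐ (v∈ i₀)))) ⟩
          (a - 1#) * 0# - c * 0#
            ≈⟨ solve 2 (λ x y → x :* :0 :- y :* :0 := :0) refl (a - 1#) c ⟩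
          0# ∎) }

    Fix⊆Origin⇒rotation : Fix g ⊆ Origin → Rotation g
    Fix⊆Origin⇒rotation Fix⊆O = 0 , ((λ ()) , record
      { member = λ () ; independent = λ _ _ () ; spanning = λ v∈ → (λ ()) , λ i → sym (Fix⊆O v∈ i) }) , ≡.refl

    rotation⇒Fix⊆Origin : Rotation g → Fix g ⊆ Origin
    rotation⇒Fix⊆Origin (zero , (b , basis) , _) v∈ i = sym (proj₂ (IsBasis.spanning basis v∈) i)
    rotation⇒Fix⊆Origin (suc zero , _ , ())
    rotation⇒Fix⊆Origin (suc (suc zero) , _ , ())
    rotation⇒Fix⊆Origin (suc (suc (suc d)) , _ , ())

    reflection⇒dimension₁ : Reflection g → Dimension (Fix g) 1
    reflection⇒dimension₁ (suc zero , dim , _) = dim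
    reflection⇒dimension₁ (suc (suc zero) , _ , ())
    reflection⇒dimension₁ (suc (suc (suc d)) , _ , ())

    ≈I⇒full : mat g ≈ₘ I → Full (Fix g)
    ≈I⇒full g≈I v i₀ = trans (+-cong (*-congʳ (g≈I i₀ i₀)) (*-congʳ (g≈I i₀ i₁))) (solve 2 (λ x y → :1 :* x :+ :0 :* y
          := x) refl (v i₀) (v i₁))
    ≈I⇒full g≈I v i₁ = trans (+-cong (*-congʳ (g≈I i₁ i₀)) (*-congʳ (g≈I i₁ i₁))) (solve 2 (λ x y → :0 :* x :+ :1 :* y
          := y) refl (v i₀) (v i₁))

  -- (det A)² is the determinant of AᵀA = I, and (det A)² - 1 factors as (det A - 1)(det A + 1).
  orthogonal-det : ∀ g → Orthogonal g → det (mat g) ≈ 1# ⊎ det (mat g) ≈ - 1#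
  orthogonal-det g gᵀg≈I with em {det (mat g) - 1# ≈ 0#}
  ... | yes p = inj₁ (-≈0⇒≈ p)
  ... | no ¬p = inj₂ (-≈0⇒≈ (integral ¬p (begin
    (det A - 1#) * (det A - - 1#)
      ≈⟨ solve 4 (λ a b c d → ((a :* d :- b :* c) :- :1) :* ((a :* d :- b :* c) :- (:- :1))
           := ((a :* a :+ c :* c) :* (b :* b :+ d :* d) :- (a :* b :+ c :* d) :* (a :* b :+ c :* d)) :- :1) refl
           (A i₀ i₀) (A i₀ i₁) (A i₁ i₀) (A i₁ i₁) ⟩
    ((A ᵀ · A) i₀ i₀ * (A ᵀ · A) i₁ i₁ - (A ᵀ · A) i₀ i₁ * (A ᵀ · A) i₀ i₁) - 1#
      ≈⟨ +-congʳ (+-cong (*-cong (gᵀg≈I i₀ i₀) (gᵀg≈I i₁ i₁)) (-‿cong (*-cong (gᵀg≈I i₀ i₁) (gᵀg≈I i₀ i₁)))) ⟩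
    (1# * 1# - 0# * 0#) - 1#
      ≈⟨ solve 0 ((:1 :* :1 :- :0 :* :0) :- :1 := :0) refl ⟩
    0# ∎)))
    where A = mat g

  -- For orthogonal A = (a b; c d), (a + d)² + (b - c)² = 2 + 2 det A.
  orthogonal-tr : ∀ g → Orthogonal g → det (mat g) ≈ - 1# → tr (mat g) ≈ 0#
  orthogonal-tr g gᵀg≈I det≈-1 = squareSum-zeroˡ (begin
    tr A * tr A + (A i₀ i₁ - A i₁ i₀) * (A i₀ i₁ - A i₁ i₀)
      ≈⟨ solve 4 (λ a b c d → (a :+ d) :* (a :+ d) :+ (b :- c) :* (b :- c)
           := ((a :* a :+ c :* c) :+ (b :* b :+ d :* d)) :+ ((a :* d :- b :* c) :+ (a :* d :- b :* c))) refl
           (A i₀ i₀) (A i₀ i₁) (A i₁ i₀) (A i₁ i₁) ⟩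
    ((A ᵀ · A) i₀ i₀ + (A ᵀ · A) i₁ i₁) + (det A + det A)
      ≈⟨ +-cong (+-cong (gᵀg≈I i₀ i₀) (gᵀg≈I i₁ i₁)) (+-cong det≈-1 det≈-1) ⟩
    (1# + 1#) + (- 1# + - 1#)
      ≈⟨ solve 0 ((:1 :+ :1) :+ ((:- :1) :+ (:- :1)) := :0) refl ⟩
    0# ∎)
    where A = mat g

  -- Multiplication by a complex number of modulus 1, whose real and imaginary parts form the first
  -- column.
  record IsRotationMatrix (A : Matrix) : Set where
    field
      diagonal     : A i₁ i₁ ≈ A i₀ i₀
      antidiagonal : A i₀ i₁ ≈ - A i₁ i₀
      norm         : A i₀ i₀ * A i₀ i₀ + A i₁ i₀ * A i₁ i₀ ≈ 1#

  -- For A = (a b; c d), (a - d)² + (b + c)² = tr (AᵀA) - 2 det A = 0, so both squares vanish.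
  orthogonal⇒rotationMatrix : ∀ g → Orthogonal g → det (mat g) ≈ 1# → IsRotationMatrix (mat g)
  orthogonal⇒rotationMatrix g gᵀg≈I det≈1 = record
    { diagonal = sym (-≈0⇒≈ (squareSum-zeroˡ eq))
    ; antidiagonal = -≈0⇒≈ (trans (solve 2 (λ b c → b :- (:- c)
          := b :+ c) refl (A i₀ i₁) (A i₁ i₀)) (squareSum-zeroʳ eq))
    ; norm = gᵀg≈I i₀ i₀
    }
    where
    A = mat g
    eq : (A i₀ i₀ - A i₁ i₁) * (A i₀ i₀ - A i₁ i₁) + (A i₀ i₁ + A i₁ i₀) * (A i₀ i₁ + A i₁ i₀) ≈ 0#
    eq = begin
      (A i₀ i₀ - A i₁ i₁) * (A i₀ i₀ - A i₁ i₁) + (A i₀ i₁ + A i₁ i₀) * (A i₀ i₁ + A i₁ i₀)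
        ≈⟨ solve 4 (λ a b c d → (a :- d) :* (a :- d) :+ (b :+ c) :* (b :+ c)
             := ((a :* a :+ c :* c) :+ (b :* b :+ d :* d)) :- ((a :* d :- b :* c) :+ (a :* d :- b :* c))) refl
             (A i₀ i₀) (A i₀ i₁) (A i₁ i₀) (A i₁ i₁) ⟩
      ((A ᵀ · A) i₀ i₀ + (A ᵀ · A) i₁ i₁) - (det A + det A)
        ≈⟨ +-cong (+-cong (gᵀg≈I i₀ i₀) (gᵀg≈I i₁ i₁)) (-‿cong (+-cong det≈1 det≈1)) ⟩
      (1# + 1#) - (1# + 1#)
        ≈⟨ -‿inverseʳ _ ⟩
      0# ∎

  -- Here det (A - I) = -1 - 0 + 1 = 0, while A = I would give determinant 1. Both hypotheses are
  -- conjugation invariant, so they may be verified on an orthogonal conjugate.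
  det-tr⇒reflection : ∀ g → det (mat g) ≈ - 1# → tr (mat g) ≈ 0# → Reflection g
  det-tr⇒reflection g det≈-1 tr≈0 = singular⇒reflection g
    (trans (+-congʳ (+-cong det≈-1 (-‿cong tr≈0))) (solve 0 ((:- :1) :- :0 :+ :1 := :0) refl))
    (λ g≈I → 0<⇒≉ 0<2 (begin
      1# + 1#              ≈⟨ +-congˡ (trans (sym det-I) (det-cong (λ i j → sym (g≈I i j)))) ⟩
      1# + det (mat g)     ≈⟨ +-congˡ det≈-1 ⟩
      1# + - 1#            ≈⟨ -‿inverseʳ 1# ⟩
      0#                   ∎))

-- The invariant inner product and conjugation into the orthogonal group.

module InvariantForm (em : ExcludedMiddle 0ℓ) (ℝ : CompleteOrderedField) where
  open Plane ℝ
  open OrderedField em ℝ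
  open PlaneGeometry em ℝ
  open CompleteOrderedField ℝ using (inverse; ≤-isTotalOrder)
  open IsTotalOrder ≤-isTotalOrder using () renaming (trans to ≤-trans; refl to ≤-refl)
  open IntegerCoefficients (CompleteOrderedField.commutativeRing ℝ)
  open CommutativeRing (CompleteOrderedField.commutativeRing ℝ)
    using (refl; sym; trans; +-cong; +-congˡ; +-congʳ; *-cong; *-congˡ; *-congʳ; -‿cong;
      *-comm; zeroʳ; -‿inverseʳ; +-commutativeMonoid; setoid)
  open Group GL₂-group using (_∙_; ε; _⁻¹) renaming (setoid to GL₂-setoid)
  open FiniteSubgroups em GL₂-group
  open Membership GL₂-setoid using () renaming (_∈_ to _∈ˡ_)
  open Unique GL₂-setoid using (Unique)
  open Relation.Binary.Reasoning.Setoid setoid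

  bilinear : Matrix → V → V → Carrier
  bilinear M u v = (M i₀ i₀ * (u i₀ * v i₀) + M i₀ i₁ * (u i₀ * v i₁))
                 + (M i₁ i₀ * (u i₁ * v i₀) + M i₁ i₁ * (u i₁ * v i₁))

  -- This is AᵀMA, written as the values of the form on pairs of columns of A so that statements
  -- about `bilinear` apply entry by entry.
  congruence : Matrix → Matrix → Matrix
  congruence M A i j = bilinear M ((A ᵀ) i) ((A ᵀ) j)

  gram : Matrix → Matrix
  gram A = A ᵀ · A

  bilinear-cong : ∀ {M N} u v → M ≈ₘ N → bilinear M u v ≈ bilinear N u v
  bilinear-cong u v p = +-cong (+-cong (*-congʳ (p i₀ i₀)) (*-congʳ (p i₀ i₁)))
    (+-cong (*-congʳ (p i₁ i₀)) (*-congʳ (p i₁ i₁)))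

  gram-cong : ∀ {A B} → A ≈ₘ B → gram A ≈ₘ gram B
  gram-cong p i j = +-cong (*-cong (p i₀ i) (p i₀ j)) (*-cong (p i₁ i) (p i₁ j))

  gram-· : ∀ A B → gram (A · B) ≈ₘ congruence (gram A) B
  gram-· A B i j = solve 8 (λ a b c d x y x′ y′ →
      (a :* x :+ b :* y) :* (a :* x′ :+ b :* y′) :+ (c :* x :+ d :* y) :* (c :* x′ :+ d :* y′) :=
      ((a :* a :+ c :* c) :* (x :* x′) :+ (a :* b :+ c :* d) :* (x :* y′)) :+
      ((b :* a :+ d :* c) :* (y :* x′) :+ (b :* b :+ d :* d) :* (y :* y′))) refl
    (A i₀ i₀) (A i₀ i₁) (A i₁ i₀) (A i₁ i₁) (B i₀ i) (B i₁ i) (B i₀ j) (B i₁ j)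

  bilinear-gram-nonNegative : ∀ A v → 0# ≤ bilinear (gram A) v v
  bilinear-gram-nonNegative A v = ≤-resp refl
    (solve 6 (λ a b c d x y → (a :* x :+ b :* y) :* (a :* x :+ b :* y) :+ (c :* x :+ d :* y) :* (c :* x :+ d :* y) :=
      ((a :* a :+ c :* c) :* (x :* x) :+ (a :* b :+ c :* d) :* (x :* y)) :+
      ((b :* a :+ d :* c) :* (y :* x) :+ (b :* b :+ d :* d) :* (y :* y))) refl
      (A i₀ i₀) (A i₀ i₁) (A i₁ i₀) (A i₁ i₁) (v i₀) (v i₁))
    (+-nonNegative (square-nonNegative _) (square-nonNegative _))

  total : List GL₂ → Matrix
  total xs i j = fold +-commutativeMonoid (λ g → gram (mat g) i j) xs

  bilinear-total : ∀ xs u v → bilinear (total xs) u v ≈ fold +-commutativeMonoid (λ g → bilinear (gram (mat g)) u v) xs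
  bilinear-total [] u v = solve 4 (λ a b c d → (:0 :* a :+ :0 :* b) :+ (:0 :* c :+ :0 :* d) := :0) refl
    (u i₀ * v i₀) (u i₀ * v i₁) (u i₁ * v i₀) (u i₁ * v i₁)
  bilinear-total (g ∷ xs) u v = trans
    (solve 12 (λ a b c d x y z w p q r s → (((a :+ x) :* p :+ (b :+ y) :* q) :+ ((c :+ z) :* r :+ (d :+ w) :* s))
        := ((a :* p :+ b :* q) :+ (c :* r :+ d :* s)) :+ ((x :* p :+ y :* q) :+ (z :* r :+ w :* s))) refl
      (gram (mat g) i₀ i₀) (gram (mat g) i₀ i₁) (gram (mat g) i₁ i₀) (gram (mat g) i₁ i₁)
      (total xs i₀ i₀) (total xs i₀ i₁) (total xs i₁ i₀) (total xs i₁ i₁)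
      (u i₀ * v i₀) (u i₀ * v i₁) (u i₁ * v i₀) (u i₁ * v i₁))
    (+-congˡ (bilinear-total xs u v))

  fold-nonNegative : ∀ {f : GL₂ → Carrier} → (∀ g → 0# ≤ f g) → ∀ xs → 0# ≤ fold +-commutativeMonoid f xs
  fold-nonNegative f≥0 []       = ≤-refl
  fold-nonNegative f≥0 (x ∷ xs) = +-nonNegative (f≥0 x) (fold-nonNegative f≥0 xs)

  term≤fold : ∀ {f : GL₂ → Carrier} → (∀ g → 0# ≤ f g) → (∀ g h → mat g ≈ₘ mat h → f g ≈ f h) →
              ∀ {g xs} → g ∈ˡ xs → f g ≤ fold +-commutativeMonoid f xs
  term≤fold {f} f≥0 f-cong {g} {x ∷ xs} (here g≈x) = ≤-resp (f-cong x g (λ i j → sym (g≈x i j))) refl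
    (≤-byDifference (fold-nonNegative f≥0 xs) (solve 2 (λ x y → (x :+ y) :- x := y) refl _ _))
  term≤fold {f} f≥0 f-cong {g} {x ∷ xs} (there g∈) = ≤-trans (term≤fold f≥0 f-cong g∈)
    (≤-byDifference (f≥0 x) (solve 2 (λ x y → (x :+ y) :- y := x) refl _ _))

  -- The summand of the identity matrix is the standard square norm, and every other summand is
  -- nonnegative. So the form is positive definite, with an explicit lower bound.
  total-positive : ∀ {xs} → ε ∈ˡ xs → ∀ v → v i₀ * v i₀ + v i₁ * v i₁ ≤ bilinear (total xs) v v
  total-positive {xs} ε∈xs v = ≤-resp
    (solve 2 (λ x y → ((:1 :* :1 :+ :0 :* :0) :* (x :* x) :+ (:1 :* :0 :+ :0 :* :1) :* (x :* y)) :+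
                      ((:0 :* :1 :+ :1 :* :0) :* (y :* x) :+ (:0 :* :0 :+ :1 :* :1) :* (y :* y))
                            := x :* x :+ y :* y) refl (v i₀) (v i₁))
    (sym (bilinear-total xs v v))
    (term≤fold {λ g → bilinear (gram (mat g)) v v} (λ g → bilinear-gram-nonNegative (mat g) v)
      (λ g h p → bilinear-cong v v (gram-cong {mat g} {mat h} p)) {ε} ε∈xs)

  -- Since hᵀ(gᵀg)h = (gh)ᵀ(gh), acting by `h` only replaces the summation index g by gh.
  total-invariant : ∀ {G : Pred GL₂ 0ℓ} {xs} → IsSubgroup G → Unique xs → G ≐ (_∈ˡ xs) →
                    ∀ {h} → h ∈ G → congruence (total xs) (mat h) ≈ₘ total xs
  total-invariant {G} {xs} G≤ xs! G≐xs {h} h∈G i j = begin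
    congruence (total xs) (mat h) i j
      ≈⟨ bilinear-total xs ((mat h ᵀ) i) ((mat h ᵀ) j) ⟩
    fold +-commutativeMonoid (λ g → congruence (gram (mat g)) (mat h) i j) xs
      ≈⟨ fold-cong xs ⟩
    fold +-commutativeMonoid (λ g → gram (mat (g ∙ h)) i j) xs
      ≈⟨ fold-translate +-commutativeMonoid G≤ xs! G≐xs {λ g → gram (mat g) i j} (λ {g} {h} p → gram-cong {mat g} {mat h} p i j) {h} h∈G ⟩
    total xs i j ∎
    where
    fold-cong : ∀ ys → fold +-commutativeMonoid (λ g → congruence (gram (mat g)) (mat h) i j) ys
                     ≈ fold +-commutativeMonoid (λ g → gram (mat (g ∙ h)) i j) ys
    fold-cong []       = refl
    fold-cong (g ∷ ys) = +-cong (sym (gram-· (mat g) (mat h) i j)) (fold-cong ys)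

  total-symmetric : ∀ xs → total xs i₁ i₀ ≈ total xs i₀ i₁
  total-symmetric []       = refl
  total-symmetric (g ∷ xs) = +-cong (+-cong (*-comm _ _) (*-comm _ _)) (total-symmetric xs)

  congruence-scale : ∀ a M A i j → congruence (λ i j → a * M i j) A i j ≈ a * congruence M A i j
  congruence-scale a M A i j = solve 9 (λ a x y z w p q r s →
      (((a :* x) :* p :+ (a :* y) :* q) :+ ((a :* z) :* r :+ (a :* w) :* s))
            := a :* ((x :* p :+ y :* q) :+ (z :* r :+ w :* s))) refl
    a (M i₀ i₀) (M i₀ i₁) (M i₁ i₀) (M i₁ i₁) _ _ _ _

  -- With h = k⁻¹xk preserving kᵀk, the matrix x = khk⁻¹ preserves the standard form: the inner kᵀk
  -- is unchanged by h and then cancelled by k⁻¹. The scalar `a` does not disturb invariance.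
  conjugate-orthogonal : ∀ k M a → (∀ i j → gram (mat k) i j ≈ a * M i j) →
                         ∀ x → congruence M (mat ((k ⁻¹ ∙ x) ∙ k)) ≈ₘ M → Orthogonal x
  conjugate-orthogonal k M a kᵀk≈aM x invariant i j = begin
    gram (mat x) i j                                ≈⟨ gram-cong {mat x} {(mat k · H) · mat⁻¹ k} x≈ i j ⟩
    gram ((mat k · H) · mat⁻¹ k) i j                ≈⟨ gram-· (mat k · H) (mat⁻¹ k) i j ⟩
    congruence (gram (mat k · H)) (mat⁻¹ k) i j     ≈⟨ bilinear-cong ((mat⁻¹ k ᵀ) i) ((mat⁻¹ k ᵀ) j) gram-kh ⟩
    congruence (gram (mat k)) (mat⁻¹ k) i j         ≈⟨ gram-· (mat k) (mat⁻¹ k) i j ⟨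
    gram (mat k · mat⁻¹ k) i j                      ≈⟨ gram-cong {mat k · mat⁻¹ k} {I} (inverseʳ k) i j ⟩
    gram I i j                                      ≈⟨ gram-I i j ⟩
    I i j                                           ∎
    where
    H : Matrix
    H = mat ((k ⁻¹ ∙ x) ∙ k)

    x≈ : mat x ≈ₘ (mat k · H) · mat⁻¹ k
    x≈ i j = sym (reconjugate k x i j)

    gram-kh : gram (mat k · H) ≈ₘ gram (mat k)
    gram-kh i j = begin
      gram (mat k · H) i j                      ≈⟨ gram-· (mat k) H i j ⟩
      congruence (gram (mat k)) H i j           ≈⟨ bilinear-cong ((H ᵀ) i) ((H ᵀ) j) kᵀk≈aM ⟩
      congruence (λ i j → a * M i j) H i j      ≈⟨ congruence-scale a M H i j ⟩
      a * congruence M H i j                    ≈⟨ *-congˡ (invariant i j) ⟩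
      a * M i j                                 ≈⟨ kᵀk≈aM i j ⟨
      gram (mat k) i j                          ∎

    gram-I : gram I ≈ₘ I
    gram-I i₀ i₀ = solve 0 (:1 :* :1 :+ :0 :* :0 := :1) refl
    gram-I i₀ i₁ = solve 0 (:1 :* :0 :+ :0 :* :1 := :0) refl
    gram-I i₁ i₀ = solve 0 (:0 :* :1 :+ :1 :* :0 := :0) refl
    gram-I i₁ i₁ = solve 0 (:0 :* :0 :+ :1 :* :1 := :1) refl

  upperTriangular : ∀ a b s → ¬ a ≈ 0# → ¬ s ≈ 0# →
                    ∃[ k ] (mat k i₀ i₀ ≈ a × mat k i₀ i₁ ≈ b × mat k i₁ i₀ ≈ 0# × mat k i₁ i₁ ≈ s)
  upperTriangular a b s a≉0 s≉0 = build (inverse a a≉0) (inverse s s≉0)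
    where
    build : (∃[ a′ ] a * a′ ≈ 1#) → (∃[ s′ ] s * s′ ≈ 1#) →
            ∃[ k ] (mat k i₀ i₀ ≈ a × mat k i₀ i₁ ≈ b × mat k i₁ i₀ ≈ 0# × mat k i₁ i₁ ≈ s)
    build (a′ , aa′≈1) (s′ , ss′≈1) = record
      { mat = K ; mat⁻¹ = K⁻¹
      ; inverseˡ = λ
        { i₀ i₀ → trans (solve 3 (λ a a′ z → a′ :* a :+ z :* :0 := a :* a′) refl a a′ _) aa′≈1
        ; i₀ i₁ → trans (solve 5 (λ a a′ b s s′ → a′ :* b :+ (:- (b :* a′ :* s′)) :* s
              := a′ :* b :* (:1 :- s :* s′)) refl a a′ b s s′)
                    (trans (*-congˡ (trans (+-congˡ (-‿cong ss′≈1)) (-‿inverseʳ 1#))) (zeroʳ _))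
        ; i₁ i₀ → solve 2 (λ a s → :0 :* a :+ s :* :0 := :0) refl a s′
        ; i₁ i₁ → trans (solve 3 (λ b s s′ → :0 :* b :+ s′ :* s := s :* s′) refl b s s′) ss′≈1 }
      ; inverseʳ = λ
        { i₀ i₀ → trans (solve 3 (λ a a′ b → a :* a′ :+ b :* :0 := a :* a′) refl a a′ b) aa′≈1
        ; i₀ i₁ → trans (solve 5 (λ a a′ b s s′ → a :* (:- (b :* a′ :* s′)) :+ b :* s′
              := b :* s′ :* (:1 :- a :* a′)) refl a a′ b s s′)
                    (trans (*-congˡ (trans (+-congˡ (-‿cong aa′≈1)) (-‿inverseʳ 1#))) (zeroʳ _))
        ; i₁ i₀ → solve 2 (λ a s → :0 :* a :+ s :* :0 := :0) refl a′ s
        ; i₁ i₁ → trans (solve 3 (λ b s s′ → :0 :* b :+ s :* s′ := s :* s′) refl (- (b * a′ * s′)) s s′) ss′≈1 }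
      } , refl , refl , refl , refl
      where
      K K⁻¹ : Matrix
      K i₀ i₀ = a
      K i₀ i₁ = b
      K i₁ i₀ = 0#
      K i₁ i₁ = s
      K⁻¹ i₀ i₀ = a′
      K⁻¹ i₀ i₁ = - (b * a′ * s′)
      K⁻¹ i₁ i₀ = 0#
      K⁻¹ i₁ i₁ = s′

  -- Completing the square: a (a x² + 2 b x y + c y²) = (a x + b y)² + (a c - b²) y².
  diagonalise : ∀ M → M i₁ i₀ ≈ M i₀ i₁ → (∀ v → v i₀ * v i₀ + v i₁ * v i₁ ≤ bilinear M v v) →
                ∃[ k ] ∀ i j → gram (mat k) i j ≈ M i₀ i₀ * M i j
  diagonalise M symmetric positive = fromSqrt (sqrt _ 0<ac-bb)
    where
    a b c : Carrier
    a = M i₀ i₀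
    b = M i₀ i₁
    c = M i₁ i₁

    -- Test vectors for positivity: the form has value a at `e`, and a (ac - b²) at `v`.
    e v : V
    e i₀ = 1#
    e i₁ = 0#
    v i₀ = - b
    v i₁ = a

    0<a : 0# < a
    0<a a≤0 = 0<1 (≤-trans (≤-resp
      (solve 0 (:1 :* :1 :+ :0 :* :0 := :1) refl)
      (solve 4 (λ a b c d → (a :* (:1 :* :1) :+ b :* (:1 :* :0)) :+ (c :* (:0 :* :1) :+ d :* (:0 :* :0))
            := a) refl a b (M i₁ i₀) c)
      (positive e)) a≤0)

    0<ac-bb : 0# < a * c - b * b
    0<ac-bb = *-cancel-positive 0<a λ p → *-positive 0<a 0<a (≤-trans
      (≤-byDifference (square-nonNegative b) (solve 2 (λ a b → ((:- b) :* (:- b) :+ a :* a) :- a :* a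
            := b :* b) refl a b))
      (≤-trans (positive v) (≤-resp (begin
        a * (a * c - b * b)
          ≈⟨ solve 3 (λ a b c → a :* (a :* c :- b :* b)
                := (a :* ((:- b) :* (:- b)) :+ b :* ((:- b) :* a)) :+ (b :* (a :* (:- b)) :+ c :* (a :* a))) refl a b c ⟩
        (a * (- b * - b) + b * (- b * a)) + (b * (a * - b) + c * (a * a))
          ≈⟨ +-congˡ (+-congʳ (*-congʳ symmetric)) ⟨
        bilinear M v v ∎) refl p)))

    -- The factor k = (a b; 0 s) satisfies kᵀk = a M. Factoring a M rather than M spares a square
    -- root of a.
    fromSqrt : (∃[ s ] (0# < s × s * s ≈ a * c - b * b)) → ∃[ k ] ∀ i j → gram (mat k) i j ≈ a * M i j
    fromSqrt (s , 0<s , ss≈) = fromTriangular (upperTriangular a b s (0<⇒≉ 0<a) (0<⇒≉ 0<s))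
      where
      fromTriangular : ∃[ k ] (mat k i₀ i₀ ≈ a × mat k i₀ i₁ ≈ b × mat k i₁ i₀ ≈ 0# × mat k i₁ i₁ ≈ s) →
                       ∃[ k ] ∀ i j → gram (mat k) i j ≈ a * M i j
      fromTriangular (k , k₀₀ , k₀₁ , k₁₀ , k₁₁) = k , λ
        { i₀ i₀ → trans (+-cong (*-cong k₀₀ k₀₀) (*-cong k₁₀ k₁₀)) (solve 1 (λ a → a :* a :+ :0 :* :0 := a :* a) refl a)
        ; i₀ i₁ → trans (+-cong (*-cong k₀₀ k₀₁) (*-cong k₁₀ k₁₁)) (solve 3 (λ a b s → a :* b :+ :0 :* s
              := a :* b) refl a b s)
        ; i₁ i₀ → trans (+-cong (*-cong k₀₁ k₀₀) (*-cong k₁₁ k₁₀)) (trans (solve 3 (λ a b s → b :* a :+ s :* :0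
              := a :* b) refl a b s)
                    (*-congˡ (sym symmetric)))
        ; i₁ i₁ → trans (+-cong (*-cong k₀₁ k₀₁) (*-cong k₁₁ k₁₁)) (trans (+-congˡ ss≈)
                    (solve 3 (λ a b c → b :* b :+ (a :* c :- b :* b) := a :* c) refl a b c)) }

  conjugate-into-O₂ : ∀ (G : Pred GL₂ 0ℓ) → IsSubgroup G → Finite G → ∃[ k ] (conjugate k G ⊆ Orthogonal)
  conjugate-into-O₂ G G≤ finite = fromEnumeration (enumeration finite)
    where
    fromEnumeration : Σ[ xs ∈ List GL₂ ] (Unique xs × G ≐ (_∈ˡ xs)) → ∃[ k ] (conjugate k G ⊆ Orthogonal)
    fromEnumeration (xs , xs! , G≐xs) = fromDiagonal
      (diagonalise (total xs) (total-symmetric xs) (total-positive (proj₁ G≐xs (IsSubgroup.ε-closed G≤))))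
      where
      fromDiagonal : (∃[ k ] ∀ i j → gram (mat k) i j ≈ total xs i₀ i₀ * total xs i j) → ∃[ k ] (conjugate k G ⊆ Orthogonal)
      fromDiagonal (k , eq) = k , λ {x} x∈ →
        conjugate-orthogonal k (total xs) (total xs i₀ i₀) eq x (total-invariant G≤ xs! G≐xs {(k ⁻¹ ∙ x) ∙ k} x∈)

-- Rotations as complex numbers of modulus 1: cosines and chord lengths.

module RotationGroups (em : ExcludedMiddle 0ℓ) (ℝ : CompleteOrderedField) where
  open Plane ℝ
  open OrderedField em ℝ
  open PlaneGeometry em ℝ
  open CompleteOrderedField ℝ using (≤-isTotalOrder; *-nonNegative)
  open IsTotalOrder ≤-isTotalOrder using (total) renaming (trans to ≤-trans)
  open IntegerCoefficients (CompleteOrderedField.commutativeRing ℝ)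
  open CommutativeRing (CompleteOrderedField.commutativeRing ℝ)
    using (refl; sym; trans; +-cong; +-congˡ; +-congʳ; *-cong; *-congˡ; *-congʳ; -‿cong;
      *-identityʳ; *-identityˡ; *-comm; -‿inverseʳ; setoid)
  open Group GL₂-group using (_∙_; _⁻¹)
  open FiniteSubgroups em GL₂-group
  open Relation.Binary.Reasoning.Setoid setoid
  open IsRotationMatrix

  re im : GL₂ → Carrier
  re g = mat g i₀ i₀
  im g = mat g i₁ i₀

  Rotational : Pred GL₂ 0ℓ
  Rotational g = IsRotationMatrix (mat g)

  rotational-≈ : ∀ g h → Rotational g → Rotational h → re g ≈ re h → im g ≈ im h → mat g ≈ₘ mat h
  rotational-≈ g h G H p q i₀ i₀ = p
  rotational-≈ g h G H p q i₁ i₀ = q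
  rotational-≈ g h G H p q i₀ i₁ = trans (antidiagonal G) (trans (-‿cong q) (sym (antidiagonal H)))
  rotational-≈ g h G H p q i₁ i₁ = trans (diagonal G) (trans p (sym (diagonal H)))

  re-∙ : ∀ g h → Rotational g → re (g ∙ h) ≈ re g * re h - im g * im h
  re-∙ g h G = trans (+-congˡ (*-congʳ (antidiagonal G)))
    (solve 4 (λ a b c d → a :* c :+ (:- b) :* d := a :* c :- b :* d) refl (re g) (im g) (re h) (im h))

  im-∙ : ∀ g h → Rotational g → im (g ∙ h) ≈ im g * re h + re g * im h
  im-∙ g h G = +-congˡ (*-congʳ (diagonal G))

  -- The shape of g⁻¹ is not presupposed. The first column of g g⁻¹ = I is a linear system for the
  -- first column of g⁻¹, solved by multiplying with the complex conjugate of g.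
  re-⁻¹ : ∀ g → Rotational g → re (g ⁻¹) ≈ re g
  re-⁻¹ g G = begin
    re (g ⁻¹)
      ≈⟨ *-identityˡ _ ⟨
    1# * re (g ⁻¹)
      ≈⟨ *-congʳ (norm G) ⟨
    (re g * re g + im g * im g) * re (g ⁻¹)
      ≈⟨ solve 4 (λ a b c d → (a :* a :+ b :* b) :* c
            := a :* (a :* c :- b :* d) :+ b :* (b :* c :+ a :* d)) refl (re g) (im g) (re (g ⁻¹)) (im (g ⁻¹)) ⟩
    re g * (re g * re (g ⁻¹) - im g * im (g ⁻¹)) + im g * (im g * re (g ⁻¹) + re g * im (g ⁻¹))
      ≈⟨ +-cong (*-congˡ (trans (sym (re-∙ g (g ⁻¹) G)) (inverseʳ g i₀ i₀)))
          (*-congˡ (trans (sym (im-∙ g (g ⁻¹) G)) (inverseʳ g i₁ i₀))) ⟩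
    re g * 1# + im g * 0#
      ≈⟨ solve 2 (λ a b → a :* :1 :+ b :* :0 := a) refl (re g) (im g) ⟩
    re g ∎

  im-⁻¹ : ∀ g → Rotational g → im (g ⁻¹) ≈ - im g
  im-⁻¹ g G = begin
    im (g ⁻¹)
      ≈⟨ *-identityˡ _ ⟨
    1# * im (g ⁻¹)
      ≈⟨ *-congʳ (norm G) ⟨
    (re g * re g + im g * im g) * im (g ⁻¹)
      ≈⟨ solve 4 (λ a b c d → (a :* a :+ b :* b) :* d
            := a :* (b :* c :+ a :* d) :- b :* (a :* c :- b :* d)) refl (re g) (im g) (re (g ⁻¹)) (im (g ⁻¹)) ⟩
    re g * (im g * re (g ⁻¹) + re g * im (g ⁻¹)) - im g * (re g * re (g ⁻¹) - im g * im (g ⁻¹))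
      ≈⟨ +-cong (*-congˡ (trans (sym (im-∙ g (g ⁻¹) G)) (inverseʳ g i₁ i₀)))
          (-‿cong (*-congˡ (trans (sym (re-∙ g (g ⁻¹) G)) (inverseʳ g i₀ i₀)))) ⟩
    re g * 0# - im g * 1#
      ≈⟨ solve 2 (λ a b → a :* :0 :- b :* :1 := :- b) refl (re g) (im g) ⟩
    - im g ∎

  re²≈1⇒im≈0 : ∀ g → Rotational g → re g * re g ≈ 1# → im g ≈ 0#
  re²≈1⇒im≈0 g G re²≈1 = square-zero (begin
    im g * im g                                     ≈⟨ solve 2 (λ a b → b :* b
          := (a :* a :+ b :* b) :- a :* a) refl (re g) (im g) ⟩
    (re g * re g + im g * im g) - re g * re g       ≈⟨ +-cong (norm G) (-‿cong re²≈1) ⟩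
    1# - 1#                                         ≈⟨ -‿inverseʳ 1# ⟩
    0#                                              ∎)

  re≈1⇒≈I : ∀ g → Rotational g → re g ≈ 1# → mat g ≈ₘ I
  re≈1⇒≈I g G re≈1 = λ
    { i₀ i₀ → re≈1
    ; i₁ i₀ → im≈0
    ; i₀ i₁ → trans (antidiagonal G) (trans (-‿cong im≈0) (solve 0 (:- :0 := :0) refl))
    ; i₁ i₁ → trans (diagonal G) re≈1 }
    where
    im≈0 : im g ≈ 0#
    im≈0 = re²≈1⇒im≈0 g G (trans (*-cong re≈1 re≈1) (*-identityʳ 1#))

  -- For a rotation det (A - I) = 2 (1 - cos), and cosine 1 forces sine 0.
  rotational-singular⇒≈I : ∀ g → Rotational g → characteristic (mat g) ≈ 0# → mat g ≈ₘ I
  rotational-singular⇒≈I g G singular = re≈1⇒≈I g G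
    (sym (-≈0⇒≈ (integral (0<⇒≉ 0<2) (trans (sym characteristic-rotational) singular))))
    where
    characteristic-rotational : characteristic (mat g) ≈ 2# * (1# - re g)
    characteristic-rotational = begin
      characteristic (mat g)
        ≈⟨ +-congʳ (+-cong (+-cong (*-congˡ (diagonal G)) (-‿cong (*-congʳ (antidiagonal G))))
            (-‿cong (+-congˡ (diagonal G)))) ⟩
      (re g * re g - (- im g) * im g) - (re g + re g) + 1#
        ≈⟨ solve 2 (λ a b → ((a :* a :- (:- b) :* b) :- (a :+ a)) :+ :1
              := (a :* a :+ b :* b) :+ (:1 :- (a :+ a))) refl (re g) (im g) ⟩
      (re g * re g + im g * im g) + (1# - (re g + re g))
        ≈⟨ +-congʳ (norm G) ⟩
      1# + (1# - (re g + re g))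
        ≈⟨ solve 1 (λ a → :1 :+ (:1 :- (a :+ a)) := :2 :* (:1 :- a)) refl (re g) ⟩
      2# * (1# - re g) ∎

  rotational⇒Fix⊆Origin : ∀ g → Rotational g → ¬ mat g ≈ₘ I → Fix g ⊆ Origin
  rotational⇒Fix⊆Origin g G g≉I = regular⇒Fix⊆Origin g λ singular → g≉I (rotational-singular⇒≈I g G singular)

  -- With x = cos α and y = cos β, 0 < β ≤ α, this says cos α < cos (α - β).
  cos-decreasing : ∀ {x y t} → 0# ≤ t → t * t ≈ (1# - x * x) * (1# - y * y) → x ≤ y → y < 1# → x < x * y + t
  cos-decreasing {x} {y} {t} 0≤t t²≈ x≤y y<1 xy+t≤x =
    -- otherwise 0 ≤ t ≤ x (1 - y), and squaring gives 1 + y ≤ 2 x² ≤ 2 y²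
    E-positive (*-cancel-nonNegative (0<y-x y<1) (≤-resp refl (begin
      (x * (1# - y) - t) * (x * (1# - y) + t)
        ≈⟨ solve 3 (λ x y t → (x :* (:1 :- y) :- t) :* (x :* (:1 :- y) :+ t)
              := (x :* (:1 :- y)) :* (x :* (:1 :- y)) :- t :* t) refl x y t ⟩
      (x * (1# - y)) * (x * (1# - y)) - t * t
        ≈⟨ +-congˡ (-‿cong t²≈) ⟩
      (x * (1# - y)) * (x * (1# - y)) - (1# - x * x) * (1# - y * y)
        ≈⟨ solve 2 (λ x y → (x :* (:1 :- y)) :* (x :* (:1 :- y)) :- (:1 :- x :* x) :* (:1 :- y :* y)
             := (:1 :- y) :* (:0 :- ((:1 :- y) :* (:1 :+ (y :+ y)) :+ :2 :* ((y :- x) :* (y :+ x))))) refl x y ⟩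
      (1# - y) * (0# - E) ∎)
      (*-nonNegative 0≤x[1-y]-t (+-nonNegative 0≤x[1-y] 0≤t))))
    where
    -- This is 1 + y - 2x², written as a sum whose first term is positive and whose second is
    -- nonnegative once 0 ≤ x ≤ y < 1.
    E : Carrier
    E = (1# - y) * (1# + (y + y)) + 2# * ((y - x) * (y + x))
    0≤x[1-y]-t : 0# ≤ x * (1# - y) - t
    0≤x[1-y]-t = ≤-resp refl (solve 3 (λ x y t → x :- (x :* y :+ t) := x :* (:1 :- y) :- t) refl x y t) (0≤y-x xy+t≤x)
    0≤x[1-y] : 0# ≤ x * (1# - y)
    0≤x[1-y] = ≤-trans 0≤t (0≤y-x⁻¹ 0≤x[1-y]-t)
    0≤x : 0# ≤ x
    0≤x = *-cancel-nonNegative (0<y-x y<1) (≤-resp refl (*-comm _ _) 0≤x[1-y])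
    0≤y : 0# ≤ y
    0≤y = ≤-trans 0≤x x≤y
    E-positive : ¬ 0# ≤ 0# - E
    E-positive p = +-positiveˡ
      (*-positive (0<y-x y<1) (+-positiveˡ 0<1 (+-nonNegative 0≤y 0≤y)))
      (*-nonNegative (<⇒≤ 0<2) (*-nonNegative (0≤y-x x≤y) (+-nonNegative 0≤y 0≤x)))
      (0≤y-x⁻¹ p)

  im²≈1-re² : ∀ g → Rotational g → im g * im g ≈ 1# - re g * re g
  im²≈1-re² g G = trans (solve 2 (λ a b → b :* b := (a :* a :+ b :* b) :- a :* a) refl (re g) (im g)) (+-congʳ (norm G))

  re<1 : ∀ g → Rotational g → ¬ mat g ≈ₘ I → re g < 1#
  re<1 g G g≉I 1≤re = g≉I (re≈1⇒≈I g G (antisym (square-cancel-≤ (<⇒≤ 0<1)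
      (≤-byDifference (square-nonNegative (im g)) (trans (+-congʳ (*-identityʳ 1#)) (sym (im²≈1-re² g G))))) 1≤re))
    where open IsTotalOrder ≤-isTotalOrder using (antisym)

  -- The angle of g is at most that of u, so one of u g, u g⁻¹ is turned towards the identity.
  re-increases : ∀ g u → Rotational g → Rotational u → ¬ mat g ≈ₘ I → re u ≤ re g →
                 re u < re (u ∙ g) ⊎ re u < re (u ∙ (g ⁻¹))
  re-increases g u G U g≉I u≤g = bySign (total 0# (im u * im g))
    where
    square : (im u * im g) * (im u * im g) ≈ (1# - re u * re u) * (1# - re g * re g)
    square = trans (solve 2 (λ a b → (a :* b) :* (a :* b) := (a :* a) :* (b :* b)) refl (im u) (im g))
      (*-cong (im²≈1-re² u U) (im²≈1-re² g G))
    -- Sines of equal sign mean that u and g turn to the same side, so g⁻¹ turns u back; for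
    -- opposite signs g does. In either case t is the absolute value of the product of the sines.
    bySign : 0# ≤ im u * im g ⊎ im u * im g ≤ 0# → re u < re (u ∙ g) ⊎ re u < re (u ∙ (g ⁻¹))
    bySign (inj₁ 0≤p) = inj₂ λ q → cos-decreasing 0≤p square u≤g (re<1 g G g≉I) (≤-resp (begin
      re (u ∙ (g ⁻¹))                           ≈⟨ re-∙ u (g ⁻¹) U ⟩
      re u * re (g ⁻¹) - im u * im (g ⁻¹)       ≈⟨ +-cong (*-congˡ (re-⁻¹ g G)) (-‿cong (*-congˡ (im-⁻¹ g G))) ⟩
      re u * re g - im u * (- im g)             ≈⟨ solve 4 (λ a b c d → a :* c :- b :* (:- d)
            := a :* c :+ b :* d) refl (re u) (im u) (re g) (im g) ⟩
      re u * re g + im u * im g                 ∎) refl q)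
    bySign (inj₂ p≤0) = inj₁ λ q → cos-decreasing (neg-nonNegative p≤0)
      (trans (solve 1 (λ x → (:- x) :* (:- x) := x :* x) refl (im u * im g)) square) u≤g (re<1 g G g≉I)
      (≤-resp (re-∙ u g U) refl q)

  -- The image of (1 , 0); for a rotation, the corresponding point of the unit circle.
  col : GL₂ → V
  col g i = mat g i i₀

  -- The chord formula: the squared distance of two points on the unit circle is 2 (1 - cos) of the
  -- angle between them. It turns comparisons of distances into comparisons of `re`.
  distance²-col : ∀ x y → Rotational x → Rotational (x ⁻¹) → Rotational y → distance² (col x) (col y) ≈ 2# * (1# - re ((x ⁻¹) ∙ y))
  distance²-col x y X X⁻¹ Y = begin
    distance² (col x) (col y)
      ≈⟨ solve 4 (λ a b c d → (a :- c) :* (a :- c) :+ (b :- d) :* (b :- d)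
           := ((a :* a :+ b :* b) :+ (c :* c :+ d :* d)) :- :2 :* (a :* c :+ b :* d)) refl (re x) (im x) (re y) (im y) ⟩
    ((re x * re x + im x * im x) + (re y * re y + im y * im y)) - 2# * (re x * re y + im x * im y)
      ≈⟨ +-cong (+-cong (norm X) (norm Y)) (-‿cong (*-congˡ (sym re-x⁻¹y))) ⟩
    (1# + 1#) - 2# * re ((x ⁻¹) ∙ y)
      ≈⟨ solve 1 (λ a → (:1 :+ :1) :- :2 :* a := :2 :* (:1 :- a)) refl (re ((x ⁻¹) ∙ y)) ⟩
    2# * (1# - re ((x ⁻¹) ∙ y)) ∎
    where
    re-x⁻¹y : re ((x ⁻¹) ∙ y) ≈ re x * re y + im x * im y
    re-x⁻¹y = trans (re-∙ (x ⁻¹) y X⁻¹)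
      (trans (+-cong (*-congʳ (re-⁻¹ x X)) (-‿cong (*-congʳ (im-⁻¹ x X))))
        (solve 4 (λ a b c d → a :* c :- (:- b) :* d := a :* c :+ b :* d) refl (re x) (im x) (re y) (im y)))

  -- The value is independent of `x`, so the polygon spanned by the powers of `g` has equal sides.
  distance²-rotate : ∀ g x → Rotational g → Rotational x → distance² (col x) (col (g ∙ x)) ≈ 2# * (1# - re g)
  distance²-rotate g x G X = begin
    distance² (col x) (col (g ∙ x))
      ≈⟨ +-cong (*-cong p p) (*-cong q q) ⟩
    (re x - (re g * re x - im g * im x)) * (re x - (re g * re x - im g * im x)) + (im x - (im g * re x + re g * im x)) * (im x - (im g * re x + re g * im x))
      ≈⟨ solve 4 (λ a b c d → (a :- (c :* a :- d :* b)) :* (a :- (c :* a :- d :* b)) :+ (b :- (d :* a :+ c :* b)) :* (b :- (d :* a :+ c :* b))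
           := (a :* a :+ b :* b) :* ((:1 :- (c :+ c)) :+ (c :* c :+ d :* d))) refl (re x) (im x) (re g) (im g) ⟩
    (re x * re x + im x * im x) * ((1# - (re g + re g)) + (re g * re g + im g * im g))
      ≈⟨ *-cong (norm X) (+-congˡ (norm G)) ⟩
    1# * ((1# - (re g + re g)) + 1#)
      ≈⟨ solve 1 (λ a → :1 :* ((:1 :- (a :+ a)) :+ :1) := :2 :* (:1 :- a)) refl (re g) ⟩
    2# * (1# - re g) ∎
    where
    p = +-congˡ (-‿cong (re-∙ g x G))
    q = +-congˡ (-‿cong (im-∙ g x G))

  orthogonal-reflection : ∀ g → Orthogonal g → det (mat g) ≈ - 1# → Reflection g
  orthogonal-reflection g g∈O det≈-1 = det-tr⇒reflection g det≈-1 (orthogonal-tr g g∈O det≈-1)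

  rotational⇒orthogonal : ∀ g → Rotational g → Orthogonal g
  rotational⇒orthogonal g G = λ
    { i₀ i₀ → norm G
    ; i₀ i₁ → trans (+-cong (*-congˡ (antidiagonal G)) (*-congˡ (diagonal G)))
        (solve 2 (λ a b → a :* (:- b) :+ b :* a := :0) refl (re g) (im g))
    ; i₁ i₀ → trans (+-cong (*-congʳ (antidiagonal G)) (*-congʳ (diagonal G)))
        (solve 2 (λ a b → (:- b) :* a :+ a :* b := :0) refl (re g) (im g))
    ; i₁ i₁ → trans (+-cong (*-cong (antidiagonal G) (antidiagonal G)) (*-cong (diagonal G) (diagonal G)))
        (trans (solve 2 (λ a b → (:- b) :* (:- b) :+ a :* a := a :* a :+ b :* b) refl (re g) (im g)) (norm G)) }

  distance²-origin : ∀ x → Rotational x → distance² (col x) 0ᵥ ≈ 1#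
  distance²-origin x X = trans
    (solve 2 (λ a b → (a :- :0) :* (a :- :0) :+ (b :- :0) :* (b :- :0) := a :* a :+ b :* b) refl (re x) (im x)) (norm X)

-- Finite rotation groups are cyclic and are the rotation subgroups of dihedral groups.

module CyclicRotationGroup (em : ExcludedMiddle 0ℓ) (ℝ : CompleteOrderedField) where
  open Plane ℝ
  open OrderedField em ℝ
  open PlaneGeometry em ℝ
  open RotationGroups em ℝ
  open CompleteOrderedField ℝ using (1≉0; ≤-isTotalOrder; *-nonNegative)
  open IntegerCoefficients (CompleteOrderedField.commutativeRing ℝ)
  open CommutativeRing (CompleteOrderedField.commutativeRing ℝ)
    using (refl; sym; trans; +-cong; +-congˡ; +-congʳ; *-congˡ; *-congʳ; -‿cong; -‿inverseʳ; setoid)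
  open Group GL₂-group using (_∙_; ε; _⁻¹)
  open Algebra.Properties.Group GL₂-group using (inverseʳ-unique; ⁻¹-involutive)
  open FiniteSubgroups em GL₂-group
  open Relation.Binary.Reasoning.Setoid setoid
  open IsRotationMatrix

  totalOrder : TotalOrder 0ℓ 0ℓ 0ℓ
  totalOrder = record { isTotalOrder = ≤-isTotalOrder }

  -- Beside generation, `closest` is recorded because it is what shows that no vertex of the orbit
  -- is nearer than the next one, while `minimal` makes the first `n` vertices distinct.
  record CyclicGenerator (H : Pred GL₂ 0ℓ) : Set where
    field
      g          : GL₂
      g∈H        : g ∈ H
      g≉I        : ¬ mat g ≈ₘ I
      closest    : ∀ x → x ∈ H → ¬ mat x ≈ₘ I → re x ≤ re g
      generates  : ∀ {x} → x ∈ H → ∃[ k ] mat (power k g) ≈ₘ mat x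
      n          : ℕ
      0<n        : 0 ℕ.< n
      gⁿ≈I       : mat (power n g) ≈ₘ I
      minimal    : ∀ m → m ℕ.< n → ¬ (0 ℕ.< m × mat (power m g) ≈ₘ I)

  module _ {H : Pred GL₂ 0ℓ} (H≤ : IsSubgroup H) (rotational : H ⊆ Rotational) where
    open IsSubgroup H≤ renaming (resp to H-resp)

    cyclic : Finite H → ∃[ x ] (x ∈ H × ¬ mat x ≈ₘ I) → CyclicGenerator H
    cyclic finite (x , x∈H , x≉I) = fromMaximum (maximum H≤ totalOrder re (λ p → p i₀ i₀) finite
      (λ z → z ∈ H × ¬ mat z ≈ₘ I)
      (λ {x} {y} x≈y (x∈H , x≉I) → H-resp x≈y x∈H , λ y≈I → x≉I λ i j → trans (x≈y i j) (y≈I i j))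
      proj₁ {x} (x∈H , x≉I))
      where
      fromMaximum : ∃[ g ] ((g ∈ H × ¬ mat g ≈ₘ I) × (∀ z → z ∈ H × ¬ mat z ≈ₘ I → re z ≤ re g)) → CyclicGenerator H
      fromMaximum (g , (g∈H , g≉I) , max) = fromOrder (order H≤ finite g∈H)
        where
        fromOrder : ∃[ n ] ((0 ℕ.< n × mat (power n g) ≈ₘ I) × ∀ m → m ℕ.< n → ¬ (0 ℕ.< m × mat (power m g) ≈ₘ I)) →
                    CyclicGenerator H
        fromOrder (n , (0<n , gⁿ≈I) , minimal) = record
          { g = g ; g∈H = g∈H ; g≉I = g≉I
          ; closest = λ x x∈H x≉I → max x (x∈H , x≉I)
          ; generates = generated-by H≤ totalOrder re (λ p → p i₀ i₀) finite g∈H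
              (λ u u∈H u≉I → re-increases g u (rotational g∈H) (rotational u∈H) g≉I (max u (u∈H , u≉I)))
          ; n = n ; 0<n = 0<n ; gⁿ≈I = gⁿ≈I ; minimal = minimal
          }

    H∩Rotation : ∀ {x} → x ∈ H → ¬ mat x ≈ₘ I → Rotation x
    H∩Rotation {x} x∈H x≉I = Fix⊆Origin⇒rotation x (rotational⇒Fix⊆Origin x (rotational x∈H) x≉I)

    module _ (C : CyclicGenerator H) where
      open CyclicGenerator C

      power∈H : ∀ k → power k g ∈ H
      power∈H = power-closed H≤ g∈H

      G-rotational : ∀ k → Rotational (power k g)
      G-rotational k = rotational (power∈H k)

      -- Because `H` consists of powers of `g`, it is enough that the single rotation `g` belongs to
      -- `D`.
      ⊆𝓡₂ : ∀ {D : Pred GL₂ 0ℓ} → g ∈ D → H ⊆ 𝓡₂ D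
      ⊆𝓡₂ {D} g∈D {x} x∈H = fromPower (generates x∈H)
        where
        fromPower : ∃[ k ] mat (power k g) ≈ₘ mat x → x ∈ 𝓡₂ D
        fromPower (k , eq) = resp {x = power k g} {x} eq
          (power-generated {D ∩ Rotation} {g} (g∈D , H∩Rotation g∈H g≉I) k)

      -- By the chord formula the distances differ by 2 (re g - re (x⁻¹y)). As x⁻¹y is an element of
      -- `H` other than 1, the choice of `g` makes this nonnegative.
      nearest-col : ∀ x y → x ∈ H → y ∈ H → ¬ col y ≈ᵥ col x →
                    distance² (col x) (col (g ∙ x)) ≤ distance² (col x) (col y)
      nearest-col x y x∈H y∈H y≉x = ≤-byDifference
        (*-nonNegative (<⇒≤ 0<2) (0≤y-x (closest ((x ⁻¹) ∙ y) (∙-closed (⁻¹-closed x∈H) y∈H)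
          (λ eq → y≉x λ i → trans (inverseʳ-unique (x ⁻¹) y eq i i₀) (⁻¹-involutive x i i₀)))))
        (begin
          distance² (col x) (col y) - distance² (col x) (col (g ∙ x))
            ≈⟨ +-cong (distance²-col x y (rotational x∈H) (rotational (⁻¹-closed x∈H)) (rotational y∈H))
                      (-‿cong (distance²-rotate g x (rotational g∈H) (rotational x∈H))) ⟩
          2# * (1# - re ((x ⁻¹) ∙ y)) - 2# * (1# - re g)
            ≈⟨ solve 2 (λ a b → :2 :* (:1 :- a) :- :2 :* (:1 :- b) := :2 :* (b :- a)) refl (re ((x ⁻¹) ∙ y)) (re g) ⟩
          2# * (re g - re ((x ⁻¹) ∙ y)) ∎)

      polygon-points : EquidistantPoints n
      polygon-points = record
        { point       = λ k → col (power k g)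
        ; periodic    = λ k i → power-periodic n g gⁿ≈I k i i₀
        ; distinct    = λ {j} {k} j<n k<n eq → power-injective n g minimal j<n k<n
            (rotational-≈ (power j g) (power k g) (G-rotational j) (G-rotational k) (eq i₀) (eq i₁))
        ; start       = refl , refl
        ; onCircle    = λ k → distance²-origin (power k g) (G-rotational k)
        ; equidistant = λ j k → trans (step j) (sym (step k))
        ; nearest     = λ j k → nearest-col (power j g) (power k g) (power∈H j) (power∈H k)
        }
        where
        step : ∀ j → distance² (col (power j g)) (col (power (suc j) g)) ≈ 2# * (1# - re g)
        step j = distance²-rotate g (power j g) (rotational g∈H) (G-rotational j)

      open EquidistantPoints polygon-points using (Points)

      orthogonal : ∀ {x} → x ∈ H → Orthogonal x
      orthogonal {x} x∈H = rotational⇒orthogonal x (rotational x∈H)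

      col∈Points : ∀ {x} → x ∈ H → col x ∈ Points
      col∈Points {x} x∈H = let k , eq = generates x∈H in k , λ i → sym (eq i i₀)

      ·ᵥ-cong : ∀ x {v w} → v ≈ᵥ w → mat x ·ᵥ v ≈ᵥ mat x ·ᵥ w
      ·ᵥ-cong x p i = +-cong (*-congˡ (p i₀)) (*-congˡ (p i₁))

      H⊆symmetries : H ⊆ SymmetryGroup Points
      H⊆symmetries {x} x∈H = orthogonal x∈H , into , onto
        where
        into : ∀ {v} → v ∈ Points → mat x ·ᵥ v ∈ Points
        into (k , v≈) = let m , eq = col∈Points (∙-closed x∈H (power∈H k)) in
          m , λ i → trans (·ᵥ-cong x v≈ i) (eq i)
        onto : ∀ {w} → w ∈ Points → ∃[ v ] (v ∈ Points × mat x ·ᵥ v ≈ᵥ w)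
        onto (k , w≈) = col ((x ⁻¹) ∙ power k g) , col∈Points (∙-closed (⁻¹-closed x∈H) (power∈H k)) ,
          λ i → trans (xx⁻¹y≈y (power k g) i i₀) (sym (w≈ i))
          where
          open Group GL₂-group using (assoc; ∙-congʳ; identityˡ) renaming (inverseʳ to ⁻¹-inverseʳ)
          xx⁻¹y≈y : ∀ y → mat (x ∙ ((x ⁻¹) ∙ y)) ≈ₘ mat y
          xx⁻¹y≈y y i j = trans (sym (assoc x (x ⁻¹) y i j)) (trans (∙-congʳ {y} {x ∙ (x ⁻¹)} {ε} (⁻¹-inverseʳ x) i j)
              (identityˡ y i j))

      -- A rotation is determined by the image of the vertex (1 , 0).
      symmetries∩Rotation⊆H : SymmetryGroup Points ∩ Rotation ⊆ H
      symmetries∩Rotation⊆H {x} ((x∈O , into , _) , x∈Rotation) = fromPoint (into (0 , λ _ → refl))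
        where
        det≈1 : det (mat x) ≈ 1#
        det≈1 = byDet (orthogonal-det x x∈O)
          where
          byDet : det (mat x) ≈ 1# ⊎ det (mat x) ≈ - 1# → det (mat x) ≈ 1#
          byDet (inj₁ p) = p
          byDet (inj₂ p) = ⊥-elim (dimension₁⇒nonzero (reflection⇒dimension₁ x (orthogonal-reflection x x∈O p))
                                    (rotation⇒Fix⊆Origin x x∈Rotation))
        image : ∀ i → (mat x ·ᵥ col ε) i ≈ col x i
        image i = solve 2 (λ a b → a :* :1 :+ b :* :0 := a) refl (mat x i i₀) (mat x i i₁)
        fromPoint : mat x ·ᵥ col ε ∈ Points → x ∈ H
        fromPoint (k , eq) = H-resp {power k g} {x}
          (rotational-≈ (power k g) x (G-rotational k) (orthogonal⇒rotationMatrix x x∈O det≈1)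
            (trans (sym (eq i₀)) (image i₀)) (trans (sym (eq i₁)) (image i₁)))
          (power∈H k)

      isPolygonGroup : 3 ℕ.≤ n → Σ[ D ∈ Pred GL₂ 0ℓ ] (IsI₂ n D × H ≐ 𝓡₂ D)
      isPolygonGroup 3≤n = SymmetryGroup Points , polygon 3≤n polygon-points ((λ p → p) , (λ p → p)) ,
        ⊆𝓡₂ {SymmetryGroup Points} (H⊆symmetries g∈H) , generated-least H≤ symmetries∩Rotation⊆H

      -- The only rotation of order 2 is -I, and -I is also the only diagonal sign matrix that fixes
      -- no nonzero vector.
      isSignGroup : n ≡ 2 → Σ[ D ∈ Pred GL₂ 0ℓ ] (IsI₂ 2 D × H ≐ 𝓡₂ D)
      isSignGroup n≡2 = SignDiagonal , two ((λ p → p) , (λ p → p)) ,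
        ⊆𝓡₂ {SignDiagonal} g∈SignDiagonal , generated-least H≤ signs∩Rotation⊆H
        where
        G = rotational g∈H

        g²≈I : mat (g ∙ g) ≈ₘ I
        g²≈I i j = trans (sym (g·gε≈g·g i j)) (≡.subst (λ n → mat (power n g) ≈ₘ I) n≡2 gⁿ≈I i j)
          where
          open Group GL₂-group using (∙-congˡ; identityʳ)
          g·gε≈g·g : mat (g ∙ (g ∙ ε)) ≈ₘ mat (g ∙ g)
          g·gε≈g·g = ∙-congˡ {g} {g ∙ ε} {g} (identityʳ g)

        -- Adding re² - im² = 1, the corner entry of g² = I, to re² + im² = 1 gives 2 re² = 2.
        re²≈1 : re g * re g ≈ 1#
        re²≈1 = -≈0⇒≈ (integral (0<⇒≉ 0<2) (begin
          2# * (re g * re g - 1#)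
            ≈⟨ solve 2 (λ a b → :2 :* (a :* a :- :1)
                  := ((a :* a :- b :* b) :+ (a :* a :+ b :* b)) :- (:1 :+ :1)) refl (re g) (im g) ⟩
          ((re g * re g - im g * im g) + (re g * re g + im g * im g)) - (1# + 1#)
            ≈⟨ +-congʳ (+-cong (trans (sym (re-∙ g g G)) (g²≈I i₀ i₀)) (norm G)) ⟩
          (1# + 1#) - (1# + 1#)
            ≈⟨ -‿inverseʳ _ ⟩
          0# ∎))

        re≈-1 : re g ≈ - 1#
        re≈-1 = -≈0⇒≈ (integral (λ p → g≉I (re≈1⇒≈I g G (-≈0⇒≈ p)))
          (trans (solve 1 (λ a → (a :- :1) :* (a :- (:- :1)) := a :* a :- :1) refl (re g)) (≈⇒-≈0 re²≈1)))

        im≈0 : im g ≈ 0#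
        im≈0 = re²≈1⇒im≈0 g G re²≈1

        g≈-I : mat g ≈ₘ diag (- 1#) (- 1#)
        g≈-I i₀ i₀ = re≈-1
        g≈-I i₁ i₀ = im≈0
        g≈-I i₀ i₁ = trans (antidiagonal G) (trans (-‿cong im≈0) (solve 0 (:- :0 := :0) refl))
        g≈-I i₁ i₁ = trans (diagonal G) re≈-1

        g∈SignDiagonal : g ∈ SignDiagonal
        g∈SignDiagonal = - 1# , - 1# , inj₂ refl , inj₂ refl , g≈-I

        signs∩Rotation⊆H : SignDiagonal ∩ Rotation ⊆ H
        signs∩Rotation⊆H {x} ((a , d , a≈ , d≈ , x≈) , x∈Rotation) = bySigns a≈ d≈
          where
          e₀ e₁ : V
          e₀ i₀ = 1#
          e₀ i₁ = 0#
          e₁ i₀ = 0#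
          e₁ i₁ = 1#
          ¬fixed₀ : ¬ a ≈ 1#
          ¬fixed₀ a≈1 = 1≉0 (rotation⇒Fix⊆Origin x x∈Rotation {e₀} (λ
            { i₀ → trans (+-congʳ (*-congʳ (trans (x≈ i₀ i₀) a≈1))) (solve 1 (λ b → :1 :* :1 :+ b :* :0
                  := :1) refl (mat x i₀ i₁))
            ; i₁ → trans (+-congʳ (*-congʳ (x≈ i₁ i₀))) (solve 1 (λ b → :0 :* :1 :+ b :* :0
                  := :0) refl (mat x i₁ i₁)) }) i₀)
          ¬fixed₁ : ¬ d ≈ 1#
          ¬fixed₁ d≈1 = 1≉0 (rotation⇒Fix⊆Origin x x∈Rotation {e₁} (λ
            { i₀ → trans (+-congˡ (*-congʳ (x≈ i₀ i₁))) (solve 1 (λ b → b :* :0 :+ :0 :* :1 := :0) refl (mat x i₀ i₀))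
            ; i₁ → trans (+-congˡ (*-congʳ (trans (x≈ i₁ i₁) d≈1))) (solve 1 (λ b → b :* :0 :+ :1 :* :1
                  := :1) refl (mat x i₁ i₀)) }) i₁)
          diag-cong : a ≈ - 1# → d ≈ - 1# → diag a d ≈ₘ diag (- 1#) (- 1#)
          diag-cong p q i₀ i₀ = p
          diag-cong p q i₀ i₁ = refl
          diag-cong p q i₁ i₀ = refl
          diag-cong p q i₁ i₁ = q
          bySigns : a ≈ 1# ⊎ a ≈ - 1# → d ≈ 1# ⊎ d ≈ - 1# → x ∈ H
          bySigns (inj₁ a≈1) _          = ⊥-elim (¬fixed₀ a≈1)
          bySigns _          (inj₁ d≈1) = ⊥-elim (¬fixed₁ d≈1)
          bySigns (inj₂ p)   (inj₂ q)   = H-resp {g} {x}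
            (λ i j → trans (g≈-I i j) (sym (trans (x≈ i j) (diag-cong p q i j)))) g∈H

      isRotationSubgroup : Σ[ n ∈ ℕ ] (2 ℕ.≤ n × (Σ[ D ∈ Pred GL₂ 0ℓ ] (IsI₂ n D × H ≐ 𝓡₂ D)))
      isRotationSubgroup = byOrder n ≡.refl
        where
        -- Order 1 would make `g` the identity. Order 2 is separate because `IsI₂ 2` is given by
        -- sign matrices instead of a polygon.
        byOrder : ∀ m → m ≡ n → Σ[ n ∈ ℕ ] (2 ℕ.≤ n × (Σ[ D ∈ Pred GL₂ 0ℓ ] (IsI₂ n D × H ≐ 𝓡₂ D)))
        byOrder zero                0≡n = ⊥-elim (ℕ.<-irrefl 0≡n 0<n)
        byOrder (suc zero)          1≡n = ⊥-elim (g≉I λ i j → trans (sym (identityʳ g i j)) (≡.subst (λ n → mat (power n g) ≈ₘ I) (≡.sym 1≡n) gⁿ≈I i j))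
          where open Group GL₂-group using (identityʳ)
        byOrder (suc (suc zero))    2≡n = 2 , s≤s (s≤s z≤n) , isSignGroup (≡.sym 2≡n)
        byOrder (suc (suc (suc m))) eq  = n , ≡.subst (2 ℕ.≤_) eq (s≤s (s≤s z≤n)) , isPolygonGroup (≡.subst (3 ℕ.≤_) eq (s≤s (s≤s (s≤s z≤n))))

-- Finite linear groups not generated in codimension 1, and their arrangements.

lower-em : ExcludedMiddle (lsuc 0ℓ) → ExcludedMiddle 0ℓ
lower-em em = map′ lower lift em

module FiniteLinearGroup (em : ExcludedMiddle 0ℓ) (ℝ : CompleteOrderedField) where
  open Plane ℝ
  open OrderedField em ℝ
  open PlaneGeometry em ℝ
  open InvariantForm em ℝ
  open RotationGroups em ℝ using (Rotational; rotational-singular⇒≈I)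
  open CyclicRotationGroup em ℝ using (cyclic; isRotationSubgroup)
  open IntegerCoefficients (CompleteOrderedField.commutativeRing ℝ)
  open CommutativeRing (CompleteOrderedField.commutativeRing ℝ)
    using (refl; sym; trans; +-cong; +-congʳ; *-cong; *-congˡ; -‿cong; *-identityʳ)
  open Group GL₂-group using (_∙_; ε; _⁻¹)
  open FiniteSubgroups em GL₂-group

  module _ {G : Pred GL₂ 0ℓ} (G≤ : IsSubgroup G) (k : GL₂) (kGk⁻¹⊆O : conjugate k G ⊆ Orthogonal) where
    open IsSubgroup G≤ renaming (resp to G-resp)

    private
      -- The passage from G to its orthogonal conjugate, inverse to the map x ↦ k⁻¹xk that defines
      -- `conjugate k G`. Determinants and traces are evaluated there and carried back.
      _ᵏ : GL₂ → GL₂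
      x ᵏ = (k ∙ x) ∙ (k ⁻¹)

      ᵏ∈ : ∀ x → x ∈ G → (x ᵏ) ∈ conjugate k G
      ᵏ∈ x x∈G = G-resp {x} {((k ⁻¹) ∙ (x ᵏ)) ∙ k} (λ i j → sym (unconjugate k x i j)) x∈G

      ᵏ∈O : ∀ x → x ∈ G → (x ᵏ) ∈ Orthogonal
      ᵏ∈O x x∈G = kGk⁻¹⊆O {x ᵏ} (ᵏ∈ x x∈G)

      det-ᵏ : ∀ x → det (mat (x ᵏ)) ≈ det (mat x)
      det-ᵏ x = trans (sym (det-conjugate k (x ᵏ))) (det-cong {mat (((k ⁻¹) ∙ (x ᵏ)) ∙ k)} {mat x} (unconjugate k x))

      tr-ᵏ : ∀ x → tr (mat (x ᵏ)) ≈ tr (mat x)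
      tr-ᵏ x = trans (sym (tr-conjugate k (x ᵏ))) (tr-cong {mat (((k ⁻¹) ∙ (x ᵏ)) ∙ k)} {mat x} (unconjugate k x))

    det≈±1 : ∀ x → x ∈ G → det (mat x) ≈ 1# ⊎ det (mat x) ≈ - 1#
    det≈±1 x x∈G = transport (orthogonal-det (x ᵏ) (ᵏ∈O x x∈G))
      where
      transport : det (mat (x ᵏ)) ≈ 1# ⊎ det (mat (x ᵏ)) ≈ - 1# → det (mat x) ≈ 1# ⊎ det (mat x) ≈ - 1#
      transport (inj₁ p) = inj₁ (trans (sym (det-ᵏ x)) p)
      transport (inj₂ p) = inj₂ (trans (sym (det-ᵏ x)) p)

    det≈-1⇒reflection : ∀ x → x ∈ G → det (mat x) ≈ - 1# → Reflection x
    det≈-1⇒reflection x x∈G det≈-1 = det-tr⇒reflection x det≈-1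
      (trans (sym (tr-ᵏ x)) (orthogonal-tr (x ᵏ) (ᵏ∈O x x∈G) (trans (det-ᵏ x) det≈-1)))

    ᵏ-rotational : ∀ x → x ∈ G → det (mat x) ≈ 1# → Rotational (x ᵏ)
    ᵏ-rotational x x∈G det≈1 = orthogonal⇒rotationMatrix (x ᵏ) (ᵏ∈O x x∈G) (trans (det-ᵏ x) det≈1)

    -- Were det (A - I) zero, it would be zero for the conjugate rotation too, which would then be
    -- the identity, and so would `x`.
    det≈1⇒Fix⊆Origin : ∀ x → x ∈ G → det (mat x) ≈ 1# → ¬ mat x ≈ₘ I → Fix x ⊆ Origin
    det≈1⇒Fix⊆Origin x x∈G det≈1 x≉I = regular⇒Fix⊆Origin x λ singular →
      x≉I (conjugate-≈ε k x (rotational-singular⇒≈I (x ᵏ) (ᵏ-rotational x x∈G det≈1)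
        (trans (+-congʳ (+-cong (det-ᵏ x) (-‿cong (tr-ᵏ x)))) singular)))

    -- An element of determinant 1 fixes either the whole plane or only the origin, and neither is a
    -- line.
    reflection⇒det≈-1 : ∀ x → x ∈ G → Reflection x → det (mat x) ≈ - 1#
    reflection⇒det≈-1 x x∈G reflection = byDet (det≈±1 x x∈G) em
      where
      byDet : det (mat x) ≈ 1# ⊎ det (mat x) ≈ - 1# → Dec (mat x ≈ₘ I) → det (mat x) ≈ - 1#
      byDet (inj₂ p) _         = p
      byDet (inj₁ p) (yes x≈I) = ⊥-elim (dimension₁⇒¬full (reflection⇒dimension₁ x reflection) (≈I⇒full x x≈I))
      byDet (inj₁ p) (no x≉I)  = ⊥-elim (dimension₁⇒nonzero (reflection⇒dimension₁ x reflection)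
                                   (det≈1⇒Fix⊆Origin x x∈G p x≉I))

    -- An element h of determinant 1 is g⁻¹ (g h), where g h is again a reflection.
    reflection⇒generatedInCodim1 : ∀ g → g ∈ G → Reflection g → GeneratedInCodim1 G
    reflection⇒generatedInCodim1 g g∈G reflection = generated-least G≤ proj₁ , λ {x} → generated x
      where
      fromReflection : ∀ x → x ∈ G → det (mat x) ≈ - 1# → x ∈ ⟨ G ∩ CodimAtMost1 ⟩
      fromReflection x x∈G det≈-1 = gen (x∈G , 1 , s≤s z≤n , det≈-1⇒reflection x x∈G det≈-1)

      g-generated : g ∈ ⟨ G ∩ CodimAtMost1 ⟩
      g-generated = gen (g∈G , 1 , s≤s z≤n , reflection)

      open Group GL₂-group using (assoc; ∙-congʳ; identityˡ) renaming (inverseˡ to ⁻¹-inverseˡ)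
      g⁻¹gx≈x : ∀ x → mat ((g ⁻¹) ∙ (g ∙ x)) ≈ₘ mat x
      g⁻¹gx≈x x i j = trans (sym (assoc (g ⁻¹) g x i j)) (trans (∙-congʳ {x} {(g ⁻¹) ∙ g} {ε} (⁻¹-inverseˡ g) i j)
          (identityˡ x i j))

      generated : ∀ x → x ∈ G → x ∈ ⟨ G ∩ CodimAtMost1 ⟩
      generated x x∈G = byDet (det≈±1 x x∈G)
        where
        byDet : det (mat x) ≈ 1# ⊎ det (mat x) ≈ - 1# → x ∈ ⟨ G ∩ CodimAtMost1 ⟩
        byDet (inj₂ det≈-1) = fromReflection x x∈G det≈-1
        byDet (inj₁ det≈1)  = resp {x = (g ⁻¹) ∙ (g ∙ x)} {x} (g⁻¹gx≈x x) (mul (inv g-generated)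
          (fromReflection (g ∙ x) (∙-closed g∈G x∈G) (trans (det-· (mat g) (mat x))
            (trans (*-cong (reflection⇒det≈-1 g g∈G reflection) det≈1) (*-identityʳ _)))))

    -- The identity lies in every generated subgroup. Hence a group that is not generated in
    -- codimension 1 has an element other than 1.
    trivial⇒generatedInCodim1 : (∀ x → x ∈ G → mat x ≈ₘ I) → GeneratedInCodim1 G
    trivial⇒generatedInCodim1 trivial = generated-least G≤ proj₁ ,
      λ {x} x∈G → resp {x = ε} {x} (λ i j → sym (trivial x x∈G i j)) unit

    module _ (¬generated : ¬ GeneratedInCodim1 G) where

      ¬reflection : ∀ x → x ∈ G → ¬ Reflection x
      ¬reflection x x∈G reflection = ¬generated (reflection⇒generatedInCodim1 x x∈G reflection)

      det≈1 : ∀ x → x ∈ G → det (mat x) ≈ 1#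
      det≈1 x x∈G = byDet (det≈±1 x x∈G)
        where
        byDet : det (mat x) ≈ 1# ⊎ det (mat x) ≈ - 1# → det (mat x) ≈ 1#
        byDet (inj₁ p) = p
        byDet (inj₂ p) = ⊥-elim (¬reflection x x∈G (det≈-1⇒reflection x x∈G p))

      nontrivial : ∃[ x ] (x ∈ G × ¬ mat x ≈ₘ I)
      nontrivial = byCases em
        where
        byCases : Dec (∃[ x ] (x ∈ G × ¬ mat x ≈ₘ I)) → ∃[ x ] (x ∈ G × ¬ mat x ≈ₘ I)
        byCases (yes p) = p
        byCases (no ¬p) = ⊥-elim (¬generated (trivial⇒generatedInCodim1 λ x x∈G → decide x x∈G em))
          where
          decide : ∀ x → x ∈ G → Dec (mat x ≈ₘ I) → mat x ≈ₘ I
          decide x x∈G (yes p) = p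
          decide x x∈G (no x≉I) = ⊥-elim (¬p (x , x∈G , x≉I))

      𝓡₁-trivial : 𝓡₁ G ≐ Trivial
      𝓡₁-trivial = generated-least trivial-isSubgroup (λ { {x} (x∈G , reflection) → ⊥-elim (¬reflection x x∈G reflection) }) ,
        λ {x} x≈I → resp {x = ε} {x} (λ i j → sym (x≈I i j)) unit
        where
        trivial-isSubgroup : IsSubgroup Trivial
        trivial-isSubgroup = record
          { resp      = λ p q i j → trans (sym (p i j)) (q i j)
          ; ε-closed  = λ _ _ → refl
          ; ∙-closed  = λ {x} {y} p q i j → trans (∙-cong {x} {ε} {y} {ε} p q i j) (identityˡ ε i j)
          ; ⁻¹-closed = λ {x} p i j → trans (⁻¹-cong {x} {ε} p i j) (ε⁻¹≈ε i j)
          }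
          where
          open Group GL₂-group using (∙-cong; identityˡ; ⁻¹-cong)
          open Algebra.Properties.Group GL₂-group using (ε⁻¹≈ε)

      conjugate≐𝓡₂ : Finite G → Σ[ n ∈ ℕ ] (2 ≤ℕ n × (Σ[ D ∈ Pred GL₂ 0ℓ ] (IsI₂ n D × conjugate k G ≐ 𝓡₂ D)))
      conjugate≐𝓡₂ finite = isRotationSubgroup {conjugate k G} H≤ (λ {x} → rotational {x})
        (cyclic {conjugate k G} H≤ (λ {x} → rotational {x}) (conjugate-finite G≤ finite k) nontrivialᵏ)
        where
        H≤ : IsSubgroup (conjugate k G)
        H≤ = conjugate-isSubgroup G≤ k
        rotational : conjugate k G ⊆ Rotational
        rotational {x} x∈ = orthogonal⇒rotationMatrix x (kGk⁻¹⊆O {x} x∈)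
          (trans (sym (det-conjugate k x)) (det≈1 (((k ⁻¹) ∙ x) ∙ k) x∈))
        nontrivialᵏ : ∃[ x ] (x ∈ conjugate k G × ¬ mat x ≈ₘ I)
        nontrivialᵏ = let x , x∈G , x≉I = nontrivial in
          x ᵏ , ᵏ∈ x x∈G , λ p → x≉I (conjugate-≈ε k x p)

      Fixed-nontrivial : ∀ {H : Pred GL₂ 0ℓ} → H ⊆ G → ∃[ x ] (x ∈ H × ¬ mat x ≈ₘ I) → Fixed H ≐ Origin
      Fixed-nontrivial {H} H⊆G (x , x∈H , x≉I) =
        (λ {v} v∈ → det≈1⇒Fix⊆Origin x (H⊆G x∈H) (det≈1 x (H⊆G x∈H)) x≉I (v∈ x x∈H)) ,
        λ {v} v≈0 g _ → origin-fixed g v v≈0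
        where
        origin-fixed : ∀ g v → v ≈ᵥ 0ᵥ → mat g ·ᵥ v ≈ᵥ v
        origin-fixed g v v≈0 i = trans (+-cong (*-congˡ (v≈0 i₀)) (*-congˡ (v≈0 i₁)))
          (trans (solve 2 (λ a b → a :* :0 :+ b :* :0 := :0) refl (mat g i i₀) (mat g i i₁)) (sym (v≈0 i)))

      𝓐-origin : ∀ W → W ∈ 𝓐 G → W ≐ Origin
      𝓐-origin W (H , stabilizer , ¬trivial , W⊆ , ⊆W) =
        let Fixed⊆ , ⊆Fixed = Fixed-nontrivial {H} contained (nontrivialElement em) in
        (λ v∈W → Fixed⊆ (W⊆ v∈W)) , (λ v∈O → ⊆W (⊆Fixed v∈O))
        where
        open IsStabilizerSubgroup stabilizer
        open IsSubgroup isSubgroup using () renaming (resp to H-resp; ε-closed to ε∈H)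
        nontrivialElement : Dec (∃[ x ] (x ∈ H × ¬ mat x ≈ₘ I)) → ∃[ x ] (x ∈ H × ¬ mat x ≈ₘ I)
        nontrivialElement (yes p) = p
        nontrivialElement (no ¬p) = ⊥-elim (¬trivial ((λ {x} x∈H → decide x x∈H em) ,
          λ {x} x≈I → H-resp {ε} {x} (λ i j → sym (x≈I i j)) ε∈H))
          where
          decide : ∀ x → x ∈ H → Dec (mat x ≈ₘ I) → mat x ≈ₘ I
          decide x x∈H (yes p)  = p
          decide x x∈H (no x≉I) = ⊥-elim (¬p (x , x∈H , x≉I))

      -- G is its own stabilizer subgroup and is nontrivial, so the arrangement is not empty. This
      -- is what makes the origin an intersection of its members; an empty family would only give V.
      Fixed-G∈𝓐 : Fixed G ∈ 𝓐 G
      Fixed-G∈𝓐 = G , record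
        { isSubgroup = G≤
        ; contained  = λ x∈G → x∈G
        ; stabilizer = (λ {g} g∈G → g∈G , λ v v∈ → v∈ g g∈G) , proj₁
        } , (λ { (G⊆1 , _) → let x , x∈G , x≉I = nontrivial in x≉I (G⊆1 x∈G) }) , (λ p → p) , (λ p → p)

      lattice : ExcludedMiddle (lsuc 0ℓ) → (X : Pred V 0ℓ) → X ∈ 𝓛 (𝓐 G) ⇔ (X ≐ Origin ⊎ X ≐ U)
      lattice em₁ X = mk⇔ to from
        where
        to : X ∈ 𝓛 (𝓐 G) → X ≐ Origin ⊎ X ≐ U
        -- Either `F` is empty and the intersection is V, or it has a member and all its members are
        -- the origin. Deciding this quantifies over subsets of V, hence the excluded middle one
        -- level up.
        to (F , F⊆𝓐 , X⊆⋂ , ⋂⊆X) = byCases em₁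
          where
          byCases : Dec (Σ[ W ∈ Pred V 0ℓ ] W ∈ F) → X ≐ Origin ⊎ X ≐ U
          byCases (no empty)        = inj₂ ((λ _ → tt) , λ _ → ⋂⊆X λ W W∈F → ⊥-elim (empty (W , W∈F)))
          byCases (yes (W , W∈F)) = inj₁
            ( (λ v∈X → proj₁ (𝓐-origin W (F⊆𝓐 W∈F)) (X⊆⋂ v∈X W W∈F))
            , λ v∈O → ⋂⊆X λ W′ W′∈F → proj₂ (𝓐-origin W′ (F⊆𝓐 W′∈F)) v∈O )

        from : X ≐ Origin ⊎ X ≐ U → X ∈ 𝓛 (𝓐 G)
        from (inj₁ (X⊆O , O⊆X)) = 𝓐 G , (λ W∈ → W∈) ,
          (λ v∈X W W∈𝓐 → proj₂ (𝓐-origin W W∈𝓐) (X⊆O v∈X)) ,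
          λ v∈⋂ → O⊆X (proj₁ (𝓐-origin (Fixed G) Fixed-G∈𝓐) (v∈⋂ (Fixed G) Fixed-G∈𝓐))
        -- The empty subfamily, whose intersection is V.
        from (inj₂ (_ , U⊆X)) = (λ _ → Lift (lsuc 0ℓ) ⊥) , (λ ()) , (λ _ _ ()) , λ _ → U⊆X tt

proposition3p1 : ExcludedMiddle (lsuc 0ℓ) → (ℝ : CompleteOrderedField) →
    let open Plane ℝ in
    (G : Pred GL₂ 0ℓ) → IsSubgroup G → Finite G → ¬ GeneratedInCodim1 G →
    𝓡₁ G ≐ Trivial
    × (Σ[ n ∈ ℕ ] (2 ≤ℕ n × (Σ[ D ∈ Pred GL₂ 0ℓ ] (IsI₂ n D × EqualUpToConjugation G (𝓡₂ D)))))
    × ((X : Pred V 0ℓ) → X ∈ 𝓛 (𝓐 G) ⇔ (X ≐ Origin ⊎ X ≐ U))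
proposition3p1 em ℝ G G≤ finite ¬generated =
  let k , kGk⁻¹⊆O = conjugate-into-O₂ G G≤ finite
      n , 2≤n , D , isI₂ , kGk⁻¹≐𝓡₂ = conjugate≐𝓡₂ G≤ k (λ {x} → kGk⁻¹⊆O {x}) ¬generated finite
  in 𝓡₁-trivial G≤ k (λ {x} → kGk⁻¹⊆O {x}) ¬generated
   , (n , 2≤n , D , isI₂ , k , kGk⁻¹≐𝓡₂)
   , lattice G≤ k (λ {x} → kGk⁻¹⊆O {x}) ¬generated em
  where
  open InvariantForm (lower-em em) ℝ using (conjugate-into-O₂)
  open FiniteLinearGroup (lower-em em) ℝ using (conjugate≐𝓡₂; 𝓡₁-trivial; lattice)
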